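{- $\mathrm{ACA}_0$ does not imply weak Martin's pointed tree theorem $\mathrm{wMPT}$; that is, $\mathrm{ACA}_0\not\vdash \mathrm{wMPT}$.
   Context: All theories are in the language of second order arithmetic, with models $(N,M,0,1,+,\times,<)$, where $N$ is the number sort and $M$ is the sort of sets of numbers (equivalently, up to coding, functions from numbers to numbers, called reals). $\mathrm{ACA}_0$ is the usual system of reverse mathematics including all arithmetical comprehension axioms. $\leq_{\rm T}$ denotes Turing reducibility. A tree $T\subseteq\omega^{<\omega}$ is a set of finite strings closed under initial segments; $[T]$ is the collection of its infinite paths. A perfect tree is a nonempty tree in which every node has two incompatible extensions in the tree. A set $A$ of reals is cofinal if for every real $x$ there is some $y\in A$ with $y\geq_{\rm T} x$. Weak Martin's pointed tree theorem, $\mathrm{wMPT}$, is the statement (formulated in second order arithmetic): for every tree $T\subseteq\omega^{<\omega}$, if $[T]$ is cofinal, then $T$ has a perfect subtree. -}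

module Defs where

open import Data.Nat.Base using (ℕ; zero; suc; _+_)
open import Data.Fin.Base using (Fin; zero; suc; _↑ʳ_)
open import Data.List.Base using (List; []; _∷_; map)
open import Data.List.Membership.Propositional using (_∈_)
open import Data.Empty using () renaming (⊥ to Empty)
open import Data.Unit.Base using () renaming (⊤ to Unit)
open import Data.Product.Base using (_×_)
open import Function.Base using (id)

infixl 7 _⊗_
infixl 6 _⊕_
infix  5 _≐_ _≺_ _ϵ_ _⊑_ _⊆_ _≤ᵀ_
infix  4 ¬̇_
infixr 3 _∧_
infixr 2 _∨_
infixr 1 _⇒_
infix  1 _⇔_
infixr 0 ∀ᴺ_ ∃ᴺ_ ∀ˢ_ ∃ˢ_

------------------------------------------------------------------------
-- The language of second order arithmetic

-- `Term n`: number terms in n free number variables (de Bruijn indices).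

data Term (n : ℕ) : Set where
  var     : Fin n → Term n
  𝟘 𝟙     : Term n
  _⊕_ _⊗_ : Term n → Term n → Term n

-- `Formula m n`: formulas in m free set variables and n free number
-- variables.  Set variables are the only set terms; as usual equality of
-- sets is not primitive.

data Formula (m n : ℕ) : Set where
  _≐_ _≺_         : Term n → Term n → Formula m n
  _ϵ_             : Term n → Fin m → Formula m n
  ⊥               : Formula m n
  _∧_ _∨_ _⇒_     : Formula m n → Formula m n → Formula m n
  ∀ᴺ_ ∃ᴺ_         : Formula m (suc n) → Formula m n
  ∀ˢ_ ∃ˢ_         : Formula (suc m) n → Formula m n

Sentence : Set
Sentence = Formula 0 0

¬̇_ : ∀ {m n} → Formula m n → Formula m n
¬̇ φ = φ ⇒ ⊥

_⇔_ : ∀ {m n} → Formula m n → Formula m n → Formula m n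
φ ⇔ ψ = (φ ⇒ ψ) ∧ (ψ ⇒ φ)

Arithmetical : ∀ {m n} → Formula m n → Set
Arithmetical (s ≐ t) = Unit
Arithmetical (s ≺ t) = Unit
Arithmetical (t ϵ X) = Unit
Arithmetical ⊥       = Unit
Arithmetical (φ ∧ ψ) = Arithmetical φ × Arithmetical ψ
Arithmetical (φ ∨ ψ) = Arithmetical φ × Arithmetical ψ
Arithmetical (φ ⇒ ψ) = Arithmetical φ × Arithmetical ψ
Arithmetical (∀ᴺ φ)  = Arithmetical φ
Arithmetical (∃ᴺ φ)  = Arithmetical φ
Arithmetical (∀ˢ φ)  = Empty
Arithmetical (∃ˢ φ)  = Empty

∀ᴺ* : ∀ {m} n → Formula m n → Formula m 0
∀ᴺ* zero    φ = φ
∀ᴺ* (suc n) φ = ∀ᴺ* n (∀ᴺ φ)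

∀ˢ* : ∀ {n} m → Formula m n → Formula 0 n
∀ˢ* zero    φ = φ
∀ˢ* (suc m) φ = ∀ˢ* m (∀ˢ φ)

closure : ∀ {m n} → Formula m n → Sentence
closure {m} {n} φ = ∀ˢ* m (∀ᴺ* n φ)

------------------------------------------------------------------------
-- Substitution

subᵗ : ∀ {n n′} → (Fin n → Term n′) → Term n → Term n′
subᵗ σ (var i) = σ i
subᵗ σ 𝟘       = 𝟘
subᵗ σ 𝟙       = 𝟙
subᵗ σ (s ⊕ t) = subᵗ σ s ⊕ subᵗ σ t
subᵗ σ (s ⊗ t) = subᵗ σ s ⊗ subᵗ σ t

wk : ∀ k {n} → Term n → Term (k + n)
wk k = subᵗ (λ i → var (k ↑ʳ i))

liftᴺ : ∀ {n n′} → (Fin n → Term n′) → Fin (suc n) → Term (suc n′)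
liftᴺ σ zero    = var zero
liftᴺ σ (suc i) = wk 1 (σ i)

liftˢ : ∀ {m m′} → (Fin m → Fin m′) → Fin (suc m) → Fin (suc m′)
liftˢ ρ zero    = zero
liftˢ ρ (suc i) = suc (ρ i)

sub : ∀ {m m′ n n′} → (Fin m → Fin m′) → (Fin n → Term n′) →
      Formula m n → Formula m′ n′
sub ρ σ (s ≐ t) = subᵗ σ s ≐ subᵗ σ t
sub ρ σ (s ≺ t) = subᵗ σ s ≺ subᵗ σ t
sub ρ σ (t ϵ X) = subᵗ σ t ϵ ρ X
sub ρ σ ⊥       = ⊥
sub ρ σ (φ ∧ ψ) = sub ρ σ φ ∧ sub ρ σ ψ
sub ρ σ (φ ∨ ψ) = sub ρ σ φ ∨ sub ρ σ ψ
sub ρ σ (φ ⇒ ψ) = sub ρ σ φ ⇒ sub ρ σ ψ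
sub ρ σ (∀ᴺ φ)  = ∀ᴺ sub ρ (liftᴺ σ) φ
sub ρ σ (∃ᴺ φ)  = ∃ᴺ sub ρ (liftᴺ σ) φ
sub ρ σ (∀ˢ φ)  = ∀ˢ sub (liftˢ ρ) σ φ
sub ρ σ (∃ˢ φ)  = ∃ˢ sub (liftˢ ρ) σ φ

wkᴺ : ∀ {m n} → Formula m n → Formula m (suc n)
wkᴺ = sub id (λ i → var (suc i))

wkˢ : ∀ {m n} → Formula m n → Formula (suc m) n
wkˢ = sub suc var

inst : ∀ {A : Set} {n} → A → (Fin n → A) → Fin (suc n) → A
inst a f zero    = a
inst a f (suc i) = f i

_[_]ᴺ : ∀ {m n} → Formula m (suc n) → Term n → Formula m n
φ [ t ]ᴺ = sub id (inst t var) φ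

_[_]ˢ : ∀ {m n} → Formula (suc m) n → Fin m → Formula m n
φ [ X ]ˢ = sub (inst X id) var φ

------------------------------------------------------------------------
-- Provability: classical two-sorted natural deduction with equality for
-- numbers.  In `Th ∣ Γ ⊢ φ`, Th is a set of sentences (the axioms) and Γ
-- the list of open assumptions.

infix -1 _∣_⊢_ _⊢_

data _∣_⊢_ (Th : Sentence → Set) {m n : ℕ} (Γ : List (Formula m n)) :
           Formula m n → Set where
  ax  : ∀ {φ} → Th φ → Th ∣ Γ ⊢ sub (λ ()) (λ ()) φ
  hyp : ∀ {φ} → φ ∈ Γ → Th ∣ Γ ⊢ φ
  raa : ∀ {φ} → Th ∣ (¬̇ φ) ∷ Γ ⊢ ⊥ → Th ∣ Γ ⊢ φ
  ⇒I  : ∀ {φ ψ} → Th ∣ φ ∷ Γ ⊢ ψ → Th ∣ Γ ⊢ φ ⇒ ψ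
  ⇒E  : ∀ {φ ψ} → Th ∣ Γ ⊢ φ ⇒ ψ → Th ∣ Γ ⊢ φ → Th ∣ Γ ⊢ ψ
  ∧I  : ∀ {φ ψ} → Th ∣ Γ ⊢ φ → Th ∣ Γ ⊢ ψ → Th ∣ Γ ⊢ φ ∧ ψ
  ∧E₁ : ∀ {φ ψ} → Th ∣ Γ ⊢ φ ∧ ψ → Th ∣ Γ ⊢ φ
  ∧E₂ : ∀ {φ ψ} → Th ∣ Γ ⊢ φ ∧ ψ → Th ∣ Γ ⊢ ψ
  ∨I₁ : ∀ {φ ψ} → Th ∣ Γ ⊢ φ → Th ∣ Γ ⊢ φ ∨ ψ
  ∨I₂ : ∀ {φ ψ} → Th ∣ Γ ⊢ ψ → Th ∣ Γ ⊢ φ ∨ ψ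
  ∨E  : ∀ {φ ψ χ} → Th ∣ Γ ⊢ φ ∨ ψ →
        Th ∣ φ ∷ Γ ⊢ χ → Th ∣ ψ ∷ Γ ⊢ χ → Th ∣ Γ ⊢ χ
  ∀ᴺI : ∀ {φ} → Th ∣ map wkᴺ Γ ⊢ φ → Th ∣ Γ ⊢ ∀ᴺ φ
  ∀ᴺE : ∀ {φ} t → Th ∣ Γ ⊢ ∀ᴺ φ → Th ∣ Γ ⊢ φ [ t ]ᴺ
  ∃ᴺI : ∀ {φ} t → Th ∣ Γ ⊢ φ [ t ]ᴺ → Th ∣ Γ ⊢ ∃ᴺ φ
  ∃ᴺE : ∀ {φ χ} → Th ∣ Γ ⊢ ∃ᴺ φ →
        Th ∣ φ ∷ map wkᴺ Γ ⊢ wkᴺ χ → Th ∣ Γ ⊢ χ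
  ∀ˢI : ∀ {φ} → Th ∣ map wkˢ Γ ⊢ φ → Th ∣ Γ ⊢ ∀ˢ φ
  ∀ˢE : ∀ {φ} X → Th ∣ Γ ⊢ ∀ˢ φ → Th ∣ Γ ⊢ φ [ X ]ˢ
  ∃ˢI : ∀ {φ} X → Th ∣ Γ ⊢ φ [ X ]ˢ → Th ∣ Γ ⊢ ∃ˢ φ
  ∃ˢE : ∀ {φ χ} → Th ∣ Γ ⊢ ∃ˢ φ →
        Th ∣ φ ∷ map wkˢ Γ ⊢ wkˢ χ → Th ∣ Γ ⊢ χ
  ≐I  : ∀ {t} → Th ∣ Γ ⊢ t ≐ t
  ≐E  : ∀ {s t} φ → Th ∣ Γ ⊢ s ≐ t → Th ∣ Γ ⊢ φ [ s ]ᴺ → Th ∣ Γ ⊢ φ [ t ]ᴺ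

_⊢_ : (Sentence → Set) → Sentence → Set
Th ⊢ φ = Th ∣ [] ⊢ φ

------------------------------------------------------------------------
-- ACA₀

v₀ : ∀ {n} → Term (1 + n)
v₀ = var zero
v₁ : ∀ {n} → Term (2 + n)
v₁ = wk 1 v₀
v₂ : ∀ {n} → Term (3 + n)
v₂ = wk 1 v₁
v₃ : ∀ {n} → Term (4 + n)
v₃ = wk 1 v₂
v₄ : ∀ {n} → Term (5 + n)
v₄ = wk 1 v₃
v₅ : ∀ {n} → Term (6 + n)
v₅ = wk 1 v₄

data ACA₀ : Sentence → Set where
  suc≢0     : ACA₀ (∀ᴺ ¬̇ v₀ ⊕ 𝟙 ≐ 𝟘)
  suc-inj   : ACA₀ (∀ᴺ ∀ᴺ v₁ ⊕ 𝟙 ≐ v₀ ⊕ 𝟙 ⇒ v₁ ≐ v₀)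
  ⊕-zero    : ACA₀ (∀ᴺ v₀ ⊕ 𝟘 ≐ v₀)
  ⊕-suc     : ACA₀ (∀ᴺ ∀ᴺ v₁ ⊕ (v₀ ⊕ 𝟙) ≐ (v₁ ⊕ v₀) ⊕ 𝟙)
  ⊗-zero    : ACA₀ (∀ᴺ v₀ ⊗ 𝟘 ≐ 𝟘)
  ⊗-suc     : ACA₀ (∀ᴺ ∀ᴺ v₁ ⊗ (v₀ ⊕ 𝟙) ≐ v₁ ⊗ v₀ ⊕ v₁)
  ≺-zero    : ACA₀ (∀ᴺ ¬̇ v₀ ≺ 𝟘)
  ≺-suc     : ACA₀ (∀ᴺ ∀ᴺ v₁ ≺ v₀ ⊕ 𝟙 ⇔ v₁ ≺ v₀ ∨ v₁ ≐ v₀)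
  induction : ACA₀ (∀ˢ 𝟘 ϵ zero ∧ (∀ᴺ v₀ ϵ zero ⇒ v₀ ⊕ 𝟙 ϵ zero) ⇒
                       (∀ᴺ v₀ ϵ zero))
  -- φ may contain number and set parameters.
  comprehension : ∀ {m n} (φ : Formula m (suc n)) → Arithmetical φ →
                  ACA₀ (closure (∃ˢ ∀ᴺ v₀ ϵ zero ⇔ wkˢ φ))

------------------------------------------------------------------------
-- Pairs and finite strings of numbers

num : ∀ {n} → ℕ → Term n
num zero    = 𝟘
num (suc k) = num k ⊕ 𝟙

-- The injection (x , y) ↦ (x + y)² + x.

pair : ∀ {n} → Term n → Term n → Term n
pair x y = (x ⊕ y) ⊗ (x ⊕ y) ⊕ x

-- Gödel's β: v is the remainder of a modulo 1 + (i + 1) b.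

Beta : ∀ {m n} (a b i v : Term n) → Formula m n
Beta a b i v = v ≺ 𝟙 ⊕ (i ⊕ 𝟙) ⊗ b ∧
               (∃ᴺ wk 1 a ≐ v₀ ⊗ (𝟙 ⊕ (wk 1 i ⊕ 𝟙) ⊗ wk 1 b) ⊕ wk 1 v)

-- The number (l , (a , b)) codes the string of length l with entries
-- β(a,b,0), …, β(a,b,l-1).  A string has many codes; equality of strings is
-- equality of length and entries.

IsString : ∀ {m n} (s : Term n) → Formula m n
IsString s = ∃ᴺ ∃ᴺ ∃ᴺ wk 3 s ≐ pair v₂ (pair v₁ v₀)

-- i is less than the length of the string s, and s(i) = v.

Entry : ∀ {m n} (s i v : Term n) → Formula m n
Entry s i v = ∃ᴺ ∃ᴺ ∃ᴺ
  wk 3 s ≐ pair v₂ (pair v₁ v₀) ∧ wk 3 i ≺ v₂ ∧ Beta v₁ v₀ (wk 3 i) (wk 3 v)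

_⊑_ : ∀ {m n} (s t : Term n) → Formula m n
s ⊑ t = ∀ᴺ ∀ᴺ Entry (wk 2 s) v₁ v₀ ⇒ Entry (wk 2 t) v₁ v₀

Incompatible : ∀ {m n} (s t : Term n) → Formula m n
Incompatible s t = ¬̇ (s ⊑ t) ∧ ¬̇ (t ⊑ s)

------------------------------------------------------------------------
-- Trees and paths

-- Closure under initial segments is required for all codes, so membership in
-- a tree depends only on the string and not on its code.

IsTree : ∀ {m n} (T : Fin m) → Formula m n
IsTree T = (∀ᴺ v₀ ϵ T ⇒ IsString v₀) ∧
           (∀ᴺ ∀ᴺ v₁ ϵ T ∧ IsString v₀ ∧ v₀ ⊑ v₁ ⇒ v₀ ϵ T)

IsPerfectTree : ∀ {m n} (P : Fin m) → Formula m n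
IsPerfectTree P =
  IsTree P ∧
  (∃ᴺ v₀ ϵ P) ∧
  (∀ᴺ v₀ ϵ P ⇒
    (∃ᴺ ∃ᴺ (v₁ ϵ P ∧ v₂ ⊑ v₁) ∧ (v₀ ϵ P ∧ v₂ ⊑ v₀) ∧ Incompatible v₁ v₀))

_⊆_ : ∀ {m n} (X Y : Fin m) → Formula m n
X ⊆ Y = ∀ᴺ v₀ ϵ X ⇒ v₀ ϵ Y

-- F is the graph of a function from numbers to numbers.

IsFunction : ∀ {m n} (F : Fin m) → Formula m n
IsFunction F =
  (∀ᴺ v₀ ϵ F ⇒ (∃ᴺ ∃ᴺ v₂ ≐ pair v₁ v₀)) ∧
  (∀ᴺ ∃ᴺ pair v₁ v₀ ϵ F) ∧
  (∀ᴺ ∀ᴺ ∀ᴺ pair v₂ v₁ ϵ F ∧ pair v₂ v₀ ϵ F ⇒ v₁ ≐ v₀)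

-- F ∈ [T]: every finite initial segment of the function F belongs to T.

IsPath : ∀ {m n} (F T : Fin m) → Formula m n
IsPath F T =
  IsFunction F ∧
  (∀ᴺ IsString v₀ ∧ (∀ᴺ ∀ᴺ Entry v₂ v₁ v₀ ⇒ pair v₁ v₀ ϵ F) ⇒ v₀ ϵ T)

------------------------------------------------------------------------
-- Turing reducibility, via unlimited register machines with an oracle

-- Instructions, as numbers (op , (p , (q , l))); unused operands are ignored:
--   Z p      R_p := 0
--   S p      R_p := R_p + 1
--   T p q    R_p := R_q
--   O p      R_p := 1 if R_p is in the oracle, 0 otherwise
--   J p q l  if R_p = R_q then go to instruction l
-- A program is a string of instructions.  Execution starts at instruction 0
-- with the input in R_0 and 0 in all other registers, and halts when there
-- is no instruction to execute; the output is then in R_0.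

opZ opS opT opO opJ : ℕ
opZ = 0
opS = 1
opT = 2
opO = 3
opJ = 4

instr : ∀ {n} → ℕ → (p q l : Term n) → Term n
instr op p q l = pair (num op) (pair p (pair q l))

-- w is the value at u of the characteristic function of Y.

Char : ∀ {m n} (Y : Fin m) (u w : Term n) → Formula m n
Char Y u w = (u ϵ Y ∧ w ≐ 𝟙) ∨ ((¬̇ u ϵ Y) ∧ w ≐ 𝟘)

-- A computation is recorded by two strings: c(t) is the index of the
-- instruction to be executed at time t, and h(t , r) is the content of R_r at
-- time t.  Only registers R_r with r < k are recorded, and only these may
-- occur as operands.

Reg : ∀ {m n} (h t r x : Term n) → Formula m n
Reg h t r x = Entry h (pair t r) x

-- At time t, instruction i of the program e has operands p, q, l, assigns w to
-- R_p, and passes control to instruction i′.  (A jump assigns to R_p its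
-- current content.)

Executes : ∀ {m n} (Y : Fin m) (e h t i i′ p q l w : Term n) → Formula m n
Executes Y e h t i i′ p q l w =
    (Entry e i (instr opZ p q l) ∧ i′ ≐ i ⊕ 𝟙 ∧ w ≐ 𝟘)
  ∨ (Entry e i (instr opS p q l) ∧ i′ ≐ i ⊕ 𝟙 ∧
      (∃ᴺ Reg (wk 1 h) (wk 1 t) (wk 1 p) v₀ ∧ wk 1 w ≐ v₀ ⊕ 𝟙))
  ∨ (Entry e i (instr opT p q l) ∧ i′ ≐ i ⊕ 𝟙 ∧ Reg h t q w)
  ∨ (Entry e i (instr opO p q l) ∧ i′ ≐ i ⊕ 𝟙 ∧
      (∃ᴺ Reg (wk 1 h) (wk 1 t) (wk 1 p) v₀ ∧ Char Y v₀ (wk 1 w)))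
  ∨ (Entry e i (instr opJ p q l) ∧ Reg h t p w ∧
      (∃ᴺ Reg (wk 1 h) (wk 1 t) (wk 1 q) v₀ ∧
          ((wk 1 w ≐ v₀ ∧ wk 1 i′ ≐ wk 1 l) ∨
           ((¬̇ wk 1 w ≐ v₀) ∧ wk 1 i′ ≐ wk 1 i ⊕ 𝟙))))

-- One step, from time t to time t + 1, of the program e with oracle Y.

Step : ∀ {m n} (Y : Fin m) (e k c h t : Term n) → Formula m n
Step Y e k c h t =
  ∃ᴺ ∃ᴺ ∃ᴺ ∃ᴺ ∃ᴺ ∃ᴺ
    (let i  = v₅
         i′ = v₄
         p  = v₃
         q  = v₂
         l  = v₁
         w  = v₀
     in
     Entry (wk 6 c) (wk 6 t) i ∧ Entry (wk 6 c) (wk 6 t ⊕ 𝟙) i′ ∧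
     p ≺ wk 6 k ∧ q ≺ wk 6 k ∧
     Executes Y (wk 6 e) (wk 6 h) (wk 6 t) i i′ p q l w ∧
     Reg (wk 6 h) (wk 6 t ⊕ 𝟙) p w ∧
     (∀ᴺ v₀ ≺ wk 7 k ∧ (¬̇ v₀ ≐ wk 1 p) ⇒
       (∃ᴺ Reg (wk 8 h) (wk 8 t) v₁ v₀ ∧ Reg (wk 8 h) (wk 8 t ⊕ 𝟙) v₁ v₀)))

-- The program e with oracle Y halts on input x with output y.

Computes : ∀ {m n} (Y : Fin m) (e x y : Term n) → Formula m n
Computes Y e x y =
  ∃ᴺ ∃ᴺ ∃ᴺ ∃ᴺ
    (let k = v₃
         c = v₂
         h = v₁
         d = v₀       -- halting time
     in
     𝟘 ≺ k ∧
     Entry c 𝟘 𝟘 ∧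
     Reg h 𝟘 𝟘 (wk 4 x) ∧
     (∀ᴺ v₀ ≺ wk 1 k ∧ (¬̇ v₀ ≐ 𝟘) ⇒ Reg (wk 1 h) 𝟘 v₀ 𝟘) ∧
     (∀ᴺ v₀ ≺ wk 1 d ⇒ Step Y (wk 5 e) (wk 1 k) (wk 1 c) (wk 1 h) v₀) ∧
     (∃ᴺ Entry (wk 1 c) (wk 1 d) v₀ ∧ (¬̇ (∃ᴺ Entry (wk 6 e) v₁ v₀))) ∧
     Reg h d 𝟘 (wk 4 y))

_≤ᵀ_ : ∀ {m n} (X Y : Fin m) → Formula m n
X ≤ᵀ Y = ∃ᴺ IsString v₀ ∧
             (∀ᴺ ∃ᴺ Char X v₁ v₀ ∧ Computes Y v₂ v₁ v₀)

------------------------------------------------------------------------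
-- Weak Martin's pointed tree theorem

-- [T] is cofinal.

CofinalPaths : ∀ {m n} (T : Fin m) → Formula m n
CofinalPaths T = ∀ˢ ∃ˢ IsPath zero (suc (suc T)) ∧ suc zero ≤ᵀ zero

wMPT : Sentence
wMPT = ∀ˢ IsTree zero ∧ CofinalPaths zero ⇒
          (∃ˢ IsPerfectTree zero ∧ zero ⊆ suc zero)

{-# OPTIONS --safe #-}
-- ACA₀ holds in an ω-model whose sets are the sets definable from a
-- predicate B of true facts, and the tree T of the refutation is one of the
-- facts recorded in B.  A path of T starts with a level n and then describes
-- the kernel W n of a well-founded graph on numbers: the value at p is 0 if no
-- successor of p is in the kernel, and 1 + q if q is the least successor of p
-- in the kernel.  The vertices are formulas with environments, and passing to
-- the kernel is evaluation by iterated nor; at level n only formulas of height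
-- at most n have successors, so the path of level n is definable, and every
-- definable set is computable from the path of some level.  The values of a
-- path are forced by recursion on the depth of p, in fact already in every
-- subtree of T without dead ends; hence strings of a perfect subtree with the
-- same first entry are comparable, which is absurd.  Since T depends on B and B
-- on T, membership of a number in B is defined by recursion on the number.
--
-- The interpretation is the Gödel–Gentzen translation, so that soundness for
-- classical logic is constructive.

module Submission where

open import Defs
open import Data.Empty using () renaming (⊥ to Empty; ⊥-elim to Empty-elim)
open import Data.Fin.Base using (Fin; zero; suc; toℕ; fromℕ<)
open import Data.Fin.Properties using (toℕ<n; toℕ-fromℕ<; toℕ-injective)
open import Data.List.Base using (List; []; _∷_; length; map; tabulate)
open import Data.List.Relation.Unary.All using (All; []; _∷_)
import Data.List.Relation.Unary.All as All
open import Data.List.Relation.Unary.All.Properties using (map⁺)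
open import Data.Maybe.Base using (Maybe; just; nothing)
open import Data.Maybe.Properties using (just-injective)
open import Data.Nat.Base
  using (ℕ; zero; suc; _+_; _*_; _∸_; _≤_; _<_; z≤n; s≤s; _⊔_; _!)
import Data.Nat.Coprimality as Coprimality
open Coprimality using (Coprime; coprime-divisor; coprime-Bézout)
open import Data.Nat.Divisibility
  using (divides; ∣-trans; m∣m*n; n∣m*n; m≤n⇒m!∣n!; ∣1⇒≡1; ∣m+n∣m⇒∣n; ∣m⇒∣m*n; ∣n⇒∣m*n)
  renaming (_∣_ to _∣ᴺ_)
open import Data.Nat.DivMod
  using (_%_; _/_; m≡m%n+[m/n]*n; [m+kn]%n≡m%n; m<n⇒m%n≡m; m%n<n)
open import Data.Nat.GCD using (module Bézout)
open import Data.Nat.Induction using (<-rec)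
import Data.Nat.Properties as ℕ
open import Data.Nat.Tactic.RingSolver using (solve-∀)
open import Data.Product.Base using (Σ; ∃; _×_; _,_; proj₁; proj₂)
open import Data.Sum.Base using (_⊎_; inj₁; inj₂)
open import Data.Unit.Base using (tt) renaming (⊤ to Unit)
open import Data.Vec.Base using (Vec; []; _∷_; lookup; _[_]≔_)
open import Data.Vec.Properties using (lookup∘updateAt; lookup∘updateAt′)
open import Function.Base using (id; _∘_)
open import Relation.Binary.Definitions using (tri<; tri≈; tri>)
open import Relation.Binary.PropositionalEquality
  using (_≡_; _≢_; refl; sym; trans; cong; cong₂; subst; module ≡-Reasoning)
open import Relation.Nullary using (¬_; yes; no)
open import Relation.Nullary.Decidable using (decidable-stable; ¬¬-excluded-middle)
open import Relation.Nullary.Negation using (Stable; negated-stable)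

-- Equivalences and double negation.

infix 1 _⟺_

_⟺_ : Set → Set → Set
A ⟺ B = (A → B) × (B → A)

⟺-trans : {A B C : Set} → A ⟺ B → B ⟺ C → A ⟺ C
⟺-trans (f , g) (h , k) = h ∘ f , g ∘ k

¬-cong : {A B : Set} → A ⟺ B → (¬ A) ⟺ (¬ B)
¬-cong (f , g) = (λ ¬a b → ¬a (g b)) , (λ ¬b a → ¬b (f a))

→-cong : {A A′ B B′ : Set} → A ⟺ A′ → B ⟺ B′ → (A → B) ⟺ (A′ → B′)
→-cong (f , g) (h , k) = (λ u → h ∘ u ∘ g) , (λ u → k ∘ u ∘ f)

×-cong : {A A′ B B′ : Set} → A ⟺ A′ → B ⟺ B′ → (A × B) ⟺ (A′ × B′)
×-cong (f , g) (h , k) = (λ (a , b) → f a , h b) , (λ (a , b) → g a , k b)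

∀-cong : {I : Set} {A B : I → Set} → (∀ i → A i ⟺ B i) → (∀ i → A i) ⟺ (∀ i → B i)
∀-cong e = (λ u i → proj₁ (e i) (u i)) , (λ u i → proj₂ (e i) (u i))

infixl 1 _>>=_
_>>=_ : {A B : Set} → ¬ ¬ A → (A → ¬ ¬ B) → ¬ ¬ B
(m >>= f) k = m λ a → f a k

-- Introduction rule for the translated existential quantifiers.
ex : {I : Set} {A : I → Set} (i : I) → A i → ¬ (∀ i → ¬ A i)
ex i a k = k i a

-- Semantics and soundness

⟦_⟧ᵗ : ∀ {n} → Term n → (Fin n → ℕ) → ℕ
⟦ var i ⟧ᵗ ν = ν i
⟦ 𝟘 ⟧ᵗ     ν = 0
⟦ 𝟙 ⟧ᵗ     ν = 1
⟦ s ⊕ t ⟧ᵗ ν = ⟦ s ⟧ᵗ ν + ⟦ t ⟧ᵗ ν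
⟦ s ⊗ t ⟧ᵗ ν = ⟦ s ⟧ᵗ ν * ⟦ t ⟧ᵗ ν

⟦subᵗ⟧ : ∀ {n n′} (σ : Fin n → Term n′) {ν ν′} → (∀ i → ⟦ σ i ⟧ᵗ ν′ ≡ ν i) →
         ∀ t → ⟦ subᵗ σ t ⟧ᵗ ν′ ≡ ⟦ t ⟧ᵗ ν
⟦subᵗ⟧ σ e (var i) = e i
⟦subᵗ⟧ σ e 𝟘       = refl
⟦subᵗ⟧ σ e 𝟙       = refl
⟦subᵗ⟧ σ e (s ⊕ t) = cong₂ _+_ (⟦subᵗ⟧ σ e s) (⟦subᵗ⟧ σ e t)
⟦subᵗ⟧ σ e (s ⊗ t) = cong₂ _*_ (⟦subᵗ⟧ σ e s) (⟦subᵗ⟧ σ e t)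

module Semantics (M : Set) (_∋_ : M → ℕ → Set)
                 (∋-stable : ∀ X x → Stable (X ∋ x)) where

  Sat : ∀ {m n} → Formula m n → (Fin m → M) → (Fin n → ℕ) → Set
  Sat (s ≐ t) μ ν = ⟦ s ⟧ᵗ ν ≡ ⟦ t ⟧ᵗ ν
  Sat (s ≺ t) μ ν = ⟦ s ⟧ᵗ ν < ⟦ t ⟧ᵗ ν
  Sat (t ϵ X) μ ν = μ X ∋ ⟦ t ⟧ᵗ ν
  Sat ⊥       μ ν = Empty
  Sat (φ ∧ ψ) μ ν = Sat φ μ ν × Sat ψ μ ν
  Sat (φ ∨ ψ) μ ν = ¬ (¬ Sat φ μ ν × ¬ Sat ψ μ ν)
  Sat (φ ⇒ ψ) μ ν = Sat φ μ ν → Sat ψ μ ν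
  Sat (∀ᴺ φ)  μ ν = ∀ x → Sat φ μ (inst x ν)
  Sat (∃ᴺ φ)  μ ν = ¬ (∀ x → ¬ Sat φ μ (inst x ν))
  Sat (∀ˢ φ)  μ ν = ∀ X → Sat φ (inst X μ) ν
  Sat (∃ˢ φ)  μ ν = ¬ (∀ X → ¬ Sat φ (inst X μ) ν)

  -- Atoms are stable, and conjunction, implication, universal quantifiers and negation preserve
  -- stability; disjunctions and existentials are translated to negations. This makes `raa`, `∨E`
  -- and the existential eliminations sound constructively.
  stable : ∀ {m n} (φ : Formula m n) μ ν → Stable (Sat φ μ ν)
  stable (s ≐ t) μ ν h = decidable-stable (⟦ s ⟧ᵗ ν ℕ.≟ ⟦ t ⟧ᵗ ν) h
  stable (s ≺ t) μ ν h = decidable-stable (⟦ s ⟧ᵗ ν ℕ.<? ⟦ t ⟧ᵗ ν) h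
  stable (t ϵ X) μ ν h = ∋-stable (μ X) (⟦ t ⟧ᵗ ν) h
  stable ⊥       μ ν h = h id
  stable (φ ∧ ψ) μ ν h = stable φ μ ν (λ k → h (k ∘ proj₁)) ,
                         stable ψ μ ν (λ k → h (k ∘ proj₂))
  stable (φ ∨ ψ) μ ν h k = h (λ f → f k)
  stable (φ ⇒ ψ) μ ν h a = stable ψ μ ν (λ k → h (λ f → k (f a)))
  stable (∀ᴺ φ)  μ ν h x = stable φ μ (inst x ν) (λ k → h (λ f → k (f x)))
  stable (∃ᴺ φ)  μ ν h k = h (λ f → f k)
  stable (∀ˢ φ)  μ ν h X = stable φ (inst X μ) ν (λ k → h (λ f → k (f X)))
  stable (∃ˢ φ)  μ ν h k = h (λ f → f k)

  ⟦sub⟧ : ∀ {m m′ n n′} (ρ : Fin m → Fin m′) (σ : Fin n → Term n′) {μ μ′ ν ν′} →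
          (∀ X → μ′ (ρ X) ≡ μ X) → (∀ i → ⟦ σ i ⟧ᵗ ν′ ≡ ν i) →
          (φ : Formula m n) → Sat (sub ρ σ φ) μ′ ν′ ⟺ Sat φ μ ν
  ⟦sub⟧ ρ σ a b (s ≐ t) rewrite ⟦subᵗ⟧ σ b s | ⟦subᵗ⟧ σ b t = id , id
  ⟦sub⟧ ρ σ a b (s ≺ t) rewrite ⟦subᵗ⟧ σ b s | ⟦subᵗ⟧ σ b t = id , id
  ⟦sub⟧ ρ σ a b (t ϵ X) rewrite ⟦subᵗ⟧ σ b t | a X = id , id
  ⟦sub⟧ ρ σ a b ⊥       = id , id
  ⟦sub⟧ ρ σ a b (φ ∧ ψ) = ×-cong (⟦sub⟧ ρ σ a b φ) (⟦sub⟧ ρ σ a b ψ)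
  ⟦sub⟧ ρ σ a b (φ ∨ ψ) =
    ¬-cong (×-cong (¬-cong (⟦sub⟧ ρ σ a b φ)) (¬-cong (⟦sub⟧ ρ σ a b ψ)))
  ⟦sub⟧ ρ σ a b (φ ⇒ ψ) = →-cong (⟦sub⟧ ρ σ a b φ) (⟦sub⟧ ρ σ a b ψ)
  ⟦sub⟧ ρ σ {ν = ν} {ν′} a b (∀ᴺ φ) =
    ∀-cong λ x → ⟦sub⟧ ρ (liftᴺ σ) a (⟦liftᴺ⟧ x) φ
    where
    ⟦liftᴺ⟧ : ∀ x i → ⟦ liftᴺ σ i ⟧ᵗ (inst x ν′) ≡ inst x ν i
    ⟦liftᴺ⟧ x zero    = refl
    ⟦liftᴺ⟧ x (suc i) = trans (⟦subᵗ⟧ _ (λ _ → refl) (σ i)) (b i)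
  ⟦sub⟧ ρ σ {ν = ν} {ν′} a b (∃ᴺ φ) =
    ¬-cong (∀-cong λ x → ¬-cong (⟦sub⟧ ρ (liftᴺ σ) a (⟦liftᴺ⟧ x) φ))
    where
    ⟦liftᴺ⟧ : ∀ x i → ⟦ liftᴺ σ i ⟧ᵗ (inst x ν′) ≡ inst x ν i
    ⟦liftᴺ⟧ x zero    = refl
    ⟦liftᴺ⟧ x (suc i) = trans (⟦subᵗ⟧ _ (λ _ → refl) (σ i)) (b i)
  ⟦sub⟧ ρ σ {μ} {μ′} a b (∀ˢ φ) =
    ∀-cong λ X → ⟦sub⟧ (liftˢ ρ) σ (λ { zero → refl ; (suc i) → a i }) b φ
  ⟦sub⟧ ρ σ {μ} {μ′} a b (∃ˢ φ) =
    ¬-cong (∀-cong λ X →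
      ¬-cong (⟦sub⟧ (liftˢ ρ) σ (λ { zero → refl ; (suc i) → a i }) b φ))

  ⟦[]ᴺ⟧ : ∀ {m n} (φ : Formula m (suc n)) t {μ ν} →
          Sat (φ [ t ]ᴺ) μ ν ⟺ Sat φ μ (inst (⟦ t ⟧ᵗ ν) ν)
  ⟦[]ᴺ⟧ φ t = ⟦sub⟧ id (inst t var) (λ _ → refl)
                (λ { zero → refl ; (suc i) → refl }) φ

  ⟦[]ˢ⟧ : ∀ {m n} (φ : Formula (suc m) n) X {μ ν} →
          Sat (φ [ X ]ˢ) μ ν ⟺ Sat φ (inst (μ X) μ) ν
  ⟦[]ˢ⟧ φ X = ⟦sub⟧ (inst X id) var
                (λ { zero → refl ; (suc i) → refl }) (λ _ → refl) φ

  ⟦wkᴺ⟧ : ∀ {m n} (φ : Formula m n) {x μ ν} → Sat (wkᴺ φ) μ (inst x ν) ⟺ Sat φ μ ν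
  ⟦wkᴺ⟧ φ = ⟦sub⟧ id _ (λ _ → refl) (λ _ → refl) φ

  ⟦wkˢ⟧ : ∀ {m n} (φ : Formula m n) {X μ ν} → Sat (wkˢ φ) (inst X μ) ν ⟺ Sat φ μ ν
  ⟦wkˢ⟧ φ = ⟦sub⟧ suc var (λ _ → refl) (λ _ → refl) φ

  soundness : ∀ {Th : Sentence → Set} → (∀ {φ} → Th φ → Sat φ (λ ()) (λ ())) →
              ∀ {m n} {Γ : List (Formula m n)} {φ} → Th ∣ Γ ⊢ φ →
              ∀ {μ ν} → All (λ ψ → Sat ψ μ ν) Γ → Sat φ μ ν
  soundness {Th} axioms = go
    where
    go : ∀ {m n} {Γ : List (Formula m n)} {φ} → Th ∣ Γ ⊢ φ →
         ∀ {μ ν} → All (λ ψ → Sat ψ μ ν) Γ → Sat φ μ ν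
    wkN : ∀ {m n} {Γ : List (Formula m n)} {x μ ν} →
          All (λ ψ → Sat ψ μ ν) Γ → All (λ ψ → Sat ψ μ (inst x ν)) (map wkᴺ Γ)
    wkN γ = map⁺ (All.map (λ {φ} → proj₂ (⟦wkᴺ⟧ φ)) γ)
    wkS : ∀ {m n} {Γ : List (Formula m n)} {X μ ν} →
          All (λ ψ → Sat ψ μ ν) Γ → All (λ ψ → Sat ψ (inst X μ) ν) (map wkˢ Γ)
    wkS γ = map⁺ (All.map (λ {φ} → proj₂ (⟦wkˢ⟧ φ)) γ)
    go (ax {φ} p)   γ = proj₂ (⟦sub⟧ (λ ()) (λ ()) (λ ()) (λ ()) φ) (axioms p)
    go (hyp i)      γ = All.lookup γ i
    go (raa {φ} p)  γ = stable φ _ _ (λ k → go p (k ∷ γ))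
    go (⇒I p)       γ a = go p (a ∷ γ)
    go (⇒E p q)     γ = go p γ (go q γ)
    go (∧I p q)     γ = go p γ , go q γ
    go (∧E₁ p)      γ = proj₁ (go p γ)
    go (∧E₂ p)      γ = proj₂ (go p γ)
    go (∨I₁ p)      γ k = proj₁ k (go p γ)
    go (∨I₂ p)      γ k = proj₂ k (go p γ)
    go (∨E {χ = χ} p q r) γ =
      stable χ _ _ λ k → go p γ ((λ a → k (go q (a ∷ γ))) , (λ b → k (go r (b ∷ γ))))
    go (∀ᴺI p)      γ x = go p (wkN γ)
    go (∀ᴺE {φ} t p) γ = proj₂ (⟦[]ᴺ⟧ φ t) (go p γ _)
    go (∃ᴺI {φ} t p) γ = ex _ (proj₁ (⟦[]ᴺ⟧ φ t) (go p γ))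
    go (∃ᴺE {χ = χ} p q) γ =
      stable χ _ _ λ k → go p γ λ x a → k (proj₁ (⟦wkᴺ⟧ χ) (go q (a ∷ wkN γ)))
    go (∀ˢI p)      γ X = go p (wkS γ)
    go (∀ˢE {φ} X p) γ = proj₂ (⟦[]ˢ⟧ φ X) (go p γ _)
    go (∃ˢI {φ} X p) γ = ex _ (proj₁ (⟦[]ˢ⟧ φ X) (go p γ))
    go (∃ˢE {χ = χ} p q) γ =
      stable χ _ _ λ k → go p γ λ X a → k (proj₁ (⟦wkˢ⟧ χ) (go q (a ∷ wkS γ)))
    go ≐I           γ = refl
    go (≐E {s} {t} φ p q) {μ} {ν} γ =
      proj₂ (⟦[]ᴺ⟧ φ t)
        (subst (λ x → Sat φ μ (inst x ν)) (go p γ) (proj₁ (⟦[]ᴺ⟧ φ s) (go q γ)))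

  ⟦∀ᴺ*⟧ : ∀ {m} n (φ : Formula m n) {μ} →
          (∀ ν → Sat φ μ ν) → Sat (∀ᴺ* n φ) μ (λ ())
  ⟦∀ᴺ*⟧ zero    φ h = h _
  ⟦∀ᴺ*⟧ (suc n) φ h = ⟦∀ᴺ*⟧ n (∀ᴺ φ) λ ν x → h (inst x ν)

  ⟦∀ˢ*⟧ : ∀ m (φ : Formula m 0) → (∀ μ → Sat φ μ (λ ())) → Sat (∀ˢ* m φ) (λ ()) (λ ())
  ⟦∀ˢ*⟧ zero    φ h = h _
  ⟦∀ˢ*⟧ (suc m) φ h = ⟦∀ˢ*⟧ m (∀ˢ φ) λ μ X → h (inst X μ)

  Comprehension : Set
  Comprehension = ∀ {m n} (φ : Formula m (suc n)) → Arithmetical φ → ∀ μ ν →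
                  ∃ λ X → ∀ x → (X ∋ x) ⟺ Sat φ μ (inst x ν)

  ACA₀-sound : Comprehension → ∀ {φ} → ACA₀ φ → Sat φ (λ ()) (λ ())
  ACA₀-sound comp suc≢0   x e = ℕ.m+1+n≢0 x e
  ACA₀-sound comp suc-inj x y e = ℕ.+-cancelʳ-≡ 1 x y e
  ACA₀-sound comp ⊕-zero  x = ℕ.+-identityʳ x
  ACA₀-sound comp ⊕-suc   x y = sym (ℕ.+-assoc x y 1)
  ACA₀-sound comp ⊗-zero  x = ℕ.*-zeroʳ x
  ACA₀-sound comp ⊗-suc   x y =
    trans (ℕ.*-distribˡ-+ x y 1) (cong (x * y +_) (ℕ.*-identityʳ x))
  ACA₀-sound comp ≺-zero  x ()
  ACA₀-sound comp ≺-suc   x y = to , from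
    where
    to : x < y + 1 → ¬ (¬ (x < y) × ¬ (x ≡ y))
    to h (x≮y , x≢y) =
      x≮y (ℕ.≤∧≢⇒< (ℕ.m<1+n⇒m≤n (subst (x <_) (ℕ.+-comm y 1) h)) x≢y)
    from : ¬ (¬ (x < y) × ¬ (x ≡ y)) → x < y + 1
    from h = decidable-stable (x ℕ.<? y + 1) λ k → h
      ( (λ x<y → k (ℕ.<-≤-trans x<y (ℕ.m≤m+n y 1)))
      , (λ { refl → k (ℕ.m<m+n x (s≤s z≤n)) }))
  ACA₀-sound comp induction X (base , step) = ind
    where
    ind : ∀ x → X ∋ x
    ind zero    = base
    ind (suc x) = subst (X ∋_) (ℕ.+-comm x 1) (step x (ind x))
  ACA₀-sound comp (comprehension {m} {n} φ ar) =
    ⟦∀ˢ*⟧ m _ λ μ → ⟦∀ᴺ*⟧ n _ λ ν →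
      let X , h = comp φ ar μ ν in
      ex X λ x → ⟺-trans (h x) (proj₂ (⟦wkˢ⟧ φ) , proj₁ (⟦wkˢ⟧ φ))

-- Codes of formulas and vertices

-- The value of the term `pair`, in the same form, so that satisfaction of formulas about codes
-- unfolds to statements about `pr`.
pr : ℕ → ℕ → ℕ
pr x y = (x + y) * (x + y) + x

-- With s = x + y, s² + x ≤ s² + s < (s + 1)²: pairs with different sums have values in disjoint
-- intervals.
square-gap : ∀ {x y x′ y′} → x + y < x′ + y′ → pr x y < pr x′ y′
square-gap {x} {y} {x′} {y′} lt = begin-strict
  s * s + x             ≤⟨ ℕ.+-monoʳ-≤ (s * s) (ℕ.m≤m+n x y) ⟩
  s * s + s             <⟨ ℕ.m<n+m (s * s + s) {suc s} (s≤s z≤n) ⟩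
  suc s + (s * s + s)   ≡⟨ cong (suc s +_) (trans (ℕ.+-comm (s * s) s) (sym (ℕ.*-suc s s))) ⟩
  suc s * suc s         ≤⟨ ℕ.*-mono-≤ lt lt ⟩
  s′ * s′               ≤⟨ ℕ.m≤m+n (s′ * s′) x′ ⟩
  s′ * s′ + x′          ∎
  where
  open ℕ.≤-Reasoning
  s  = x + y
  s′ = x′ + y′

pr-injective : ∀ {x y x′ y′} → pr x y ≡ pr x′ y′ → x ≡ x′ × y ≡ y′
pr-injective {x} {y} {x′} {y′} e with ℕ.<-cmp (x + y) (x′ + y′)
... | tri< lt _ _ = Empty-elim (ℕ.<⇒≢ (square-gap {x} {y} {x′} {y′} lt) e)
... | tri> _ _ gt = Empty-elim (ℕ.<⇒≢ (square-gap {x′} {y′} {x} {y} gt) (sym e))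
... | tri≈ _ s≡s′ _ = x≡x′ , ℕ.+-cancelˡ-≡ x y y′ (trans s≡s′ (cong (_+ y′) (sym x≡x′)))
  where
  x≡x′ : x ≡ x′
  x≡x′ = ℕ.+-cancelˡ-≡ ((x + y) * (x + y)) x x′
    (trans e (cong (λ s → s * s + x′) (sym s≡s′)))

pr-injective₁ : ∀ {x y x′ y′} → pr x y ≡ pr x′ y′ → x ≡ x′
pr-injective₁ {x} {y} {x′} {y′} = proj₁ ∘ pr-injective {x} {y} {x′} {y′}

pr-injective₂ : ∀ {x y x′ y′} → pr x y ≡ pr x′ y′ → y ≡ y′
pr-injective₂ {x} {y} {x′} {y′} = proj₂ ∘ pr-injective {x} {y} {x′} {y′}

x≤pr : ∀ x y → x ≤ pr x y
x≤pr x y = ℕ.m≤n+m x _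

m≤m*m : ∀ m → m ≤ m * m
m≤m*m zero    = z≤n
m≤m*m (suc m) = ℕ.m≤m+n (suc m) _

x+y≤pr : ∀ x y → x + y ≤ pr x y
x+y≤pr x y = ℕ.≤-trans (m≤m*m (x + y)) (ℕ.m≤m+n _ x)

y≤pr : ∀ x y → y ≤ pr x y
y≤pr x y = ℕ.≤-trans (ℕ.m≤n+m y x) (x+y≤pr x y)

data Tm : Set where
  var     : ℕ → Tm
  con     : ℕ → Tm
  add mul : Tm → Tm → Tm

-- nclo t d σ denies d in the environment ev t ρ ∷ σ, where ρ is the current one;
-- it replaces substitution.
data D : Set where
  mem  : Tm → D
  nor  : D → D → D
  none : D → D
  nclo : Tm → D → List ℕ → D

-- The vertices of the graph.  At level pr k (encD d₀), the only successor of
-- root x is d₀ at x; leaf v has a successor if and only if the fact v holds.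
data Pos : Set where
  root : ℕ → Pos
  top  : Pos
  leaf : ℕ → Pos
  node : D → List ℕ → Pos

encL : List ℕ → ℕ
encL []      = 0
encL (x ∷ ρ) = suc (pr x (encL ρ))

encL-injective : ∀ ρ σ → encL ρ ≡ encL σ → ρ ≡ σ
encL-injective []      []      e = refl
encL-injective (x ∷ ρ) (y ∷ σ) e =
  let p = ℕ.suc-injective e in
  cong₂ _∷_ (pr-injective₁ {x} {_} {y} p) (encL-injective ρ σ (pr-injective₂ {x} {_} {y} p))

-- With the tag as a separate component, injectivity only has to treat terms with equal tags, that
-- is, with the same constructor.
tagT bodyT encT : Tm → ℕ
tagT (var _)   = 0
tagT (con _)   = 1
tagT (add _ _) = 2
tagT (mul _ _) = 3
bodyT (var i)   = i
bodyT (con c)   = c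
bodyT (add s t) = pr (encT s) (encT t)
bodyT (mul s t) = pr (encT s) (encT t)
encT t = pr (tagT t) (bodyT t)

encT-injective : ∀ s t → encT s ≡ encT t → s ≡ t
bodyT-injective : ∀ s t → tagT s ≡ tagT t → bodyT s ≡ bodyT t → s ≡ t
bodyT-injective (var i)   (var j)     _ e = cong var e
bodyT-injective (con i)   (con j)     _ e = cong con e
bodyT-injective (add s t) (add s′ t′) _ e =
  cong₂ add (encT-injective s s′ (pr-injective₁ {encT s} {_} {encT s′} e))
            (encT-injective t t′ (pr-injective₂ {encT s} {_} {encT s′} e))
bodyT-injective (mul s t) (mul s′ t′) _ e =
  cong₂ mul (encT-injective s s′ (pr-injective₁ {encT s} {_} {encT s′} e))
            (encT-injective t t′ (pr-injective₂ {encT s} {_} {encT s′} e))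
encT-injective s t e =
  bodyT-injective s t (pr-injective₁ {tagT s} {_} {tagT t} e) (pr-injective₂ {tagT s} {_} {tagT t} e)

tagD bodyD encD : D → ℕ
tagD (mem _)      = 0
tagD (nor _ _)    = 1
tagD (none _)     = 2
tagD (nclo _ _ _) = 3
bodyD (mem t)      = encT t
bodyD (nor a b)    = pr (encD a) (encD b)
bodyD (none a)     = encD a
bodyD (nclo t a ρ) = pr (encT t) (pr (encD a) (encL ρ))
encD d = pr (tagD d) (bodyD d)

encD-injective : ∀ a b → encD a ≡ encD b → a ≡ b
bodyD-injective : ∀ a b → tagD a ≡ tagD b → bodyD a ≡ bodyD b → a ≡ b
bodyD-injective (mem s)   (mem t)     _ e = cong mem (encT-injective s t e)
bodyD-injective (nor a b) (nor a′ b′) _ e =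
  cong₂ nor (encD-injective a a′ (pr-injective₁ {encD a} {_} {encD a′} e))
            (encD-injective b b′ (pr-injective₂ {encD a} {_} {encD a′} e))
bodyD-injective (none a)  (none a′)   _ e = cong none (encD-injective a a′ e)
bodyD-injective (nclo t a ρ) (nclo t′ a′ ρ′) _ e
  with encT-injective t t′ (pr-injective₁ {encT t} {_} {encT t′} e)
     | pr-injective₂ {encT t} {_} {encT t′} e
... | refl | e′
  with encD-injective a a′ (pr-injective₁ {encD a} {_} {encD a′} e′)
     | encL-injective ρ ρ′ (pr-injective₂ {encD a} {_} {encD a′} e′)
... | refl | refl = refl
encD-injective a b e =
  bodyD-injective a b (pr-injective₁ {tagD a} {_} {tagD b} e) (pr-injective₂ {tagD a} {_} {tagD b} e)

odd : ℕ → ℕ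
odd c = suc (c + c)

double-injective : ∀ a b → a + a ≡ b + b → a ≡ b
double-injective zero    zero    e = refl
double-injective (suc a) (suc b) e = cong suc (double-injective a b
  (ℕ.suc-injective (trans (sym (ℕ.+-suc a a)) (trans (ℕ.suc-injective e) (ℕ.+-suc b b)))))

even≢odd : ∀ a b → a + a ≢ suc (b + b)
even≢odd (suc a) zero e with trans (sym (ℕ.+-suc a a)) (ℕ.suc-injective e)
... | ()
even≢odd (suc a) (suc b) e =
  even≢odd a b (ℕ.suc-injective (trans (sym (ℕ.+-suc a a))
    (trans (ℕ.suc-injective e) (cong suc (ℕ.+-suc b b)))))

odd-tags : ∀ t x t′ x′ → odd (pr t x) ≡ odd (pr t′ x′) → t ≡ t′ × x ≡ x′
odd-tags t x t′ x′ e =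
  pr-injective {t} {x} {t′} {x′} (double-injective _ _ (ℕ.suc-injective e))

opaque
  -- Roots get the even numbers, so that an oracle machine finds them easily.
  code : Pos → ℕ
  code (root x)   = x + x
  code top        = odd (pr 0 0)
  code (leaf v)   = odd (pr 1 v)
  code (node d ρ) = odd (pr 2 (pr (encD d) (encL ρ)))

  code-injective : ∀ P Q → code P ≡ code Q → P ≡ Q
  code-injective (root x)   (root y)   e = cong root (double-injective x y e)
  code-injective (root x)   top        e = Empty-elim (even≢odd x (pr 0 0) e)
  code-injective (root x)   (leaf v)   e = Empty-elim (even≢odd x (pr 1 v) e)
  code-injective (root x)   (node d ρ) e = Empty-elim (even≢odd x (pr 2 _) e)
  code-injective top        (root y)   e = Empty-elim (even≢odd y (pr 0 0) (sym e))
  code-injective (leaf v)   (root y)   e = Empty-elim (even≢odd y (pr 1 v) (sym e))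
  code-injective (node d ρ) (root y)   e = Empty-elim (even≢odd y (pr 2 _) (sym e))
  code-injective top        top        e = refl
  code-injective top        (leaf v)   e with () ← proj₁ (odd-tags 0 0 1 v e)
  code-injective top        (node d ρ) e with () ← proj₁ (odd-tags 0 0 2 _ e)
  code-injective (leaf v)   top        e with () ← proj₁ (odd-tags 1 v 0 0 e)
  code-injective (leaf v)   (leaf w)   e = cong leaf (proj₂ (odd-tags 1 v 1 w e))
  code-injective (leaf v)   (node d ρ) e with () ← proj₁ (odd-tags 1 v 2 _ e)
  code-injective (node d ρ) top        e with () ← proj₁ (odd-tags 2 _ 0 0 e)
  code-injective (node d ρ) (leaf v)   e with () ← proj₁ (odd-tags 2 _ 1 v e)
  code-injective (node d ρ) (node d′ ρ′) e =
    let e′ = proj₂ (odd-tags 2 (pr (encD d) (encL ρ)) 2 (pr (encD d′) (encL ρ′)) e) in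
    cong₂ node (encD-injective d d′ (pr-injective₁ {encD d} {_} {encD d′} e′))
               (encL-injective ρ ρ′ (pr-injective₂ {encD d} {_} {encD d′} e′))

  code-root : ∀ x → code (root x) ≡ x + x
  code-root x = refl

  -- A leaf consults the fact predicate at `v`, hence strictly below its own code; this is what lets
  -- facts and edges be defined together by recursion on numbers.
  leaf-code> : ∀ v → v < code (leaf v)
  leaf-code> v = s≤s (ℕ.≤-trans (y≤pr 1 v) (ℕ.m≤m+n _ _))

-- The tree and the predicate of facts

nth : List ℕ → ℕ → ℕ
nth []      _       = 0
nth (x ∷ ρ) zero    = x
nth (x ∷ ρ) (suc i) = nth ρ i

ev : Tm → List ℕ → ℕ
ev (var i)   ρ = nth ρ i
ev (con c)   ρ = c
ev (add s t) ρ = ev s ρ + ev t ρ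
ev (mul s t) ρ = ev s ρ * ev t ρ

height : D → ℕ
height (mem _)      = 1
height (nor a b)    = suc (height a ⊔ height b)
height (none a)     = suc (height a)
height (nclo _ a _) = suc (height a)

child : D → List ℕ → ℕ → Pos
child (mem t)      ρ _       = leaf (ev t ρ)
child (nor a b)    ρ zero    = node a ρ
child (nor a b)    ρ (suc _) = node b ρ
child (none a)     ρ x       = node a (x ∷ ρ)
child (nclo t a σ) ρ _       = node a (ev t ρ ∷ σ)

-- The following predicates on codes of strings are what the formulas
-- Beta, Entry and IsString unfold to.

Bet : (a b i v : ℕ) → Set
Bet a b i v = v < 1 + (i + 1) * b × ¬ (∀ q → ¬ (a ≡ q * (1 + (i + 1) * b) + v))

Str : ℕ → Set
Str s = ¬ (∀ l → ¬ ¬ (∀ a → ¬ ¬ (∀ b → ¬ (s ≡ pr l (pr a b)))))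

Ent : (s i v : ℕ) → Set
Ent s i v = ¬ (∀ l → ¬ ¬ (∀ a → ¬ ¬ (∀ b → ¬ (s ≡ pr l (pr a b) × i < l × Bet a b i v))))

-- The index is below the length, and the length is at most the code. Hence `Tree` at `s` consults
-- only edges from vertices below `s`.
Ent⇒< : ∀ {s i v} → Ent s i v → i < s
Ent⇒< {s} {i} h = decidable-stable (i ℕ.<? s) λ k →
  h λ l h → h λ a h → h λ { b (refl , i<l , _) → k (ℕ.<-≤-trans i<l (x≤pr l _)) }

module _ (X : ℕ → Set) where

  Child : D → ℕ → Pos → Pos → Set
  Child d₀ n (root x)   Q = Q ≡ node d₀ (x ∷ [])
  Child d₀ n top        Q = Empty
  Child d₀ n (leaf v)   Q = Q ≡ top × X v
  Child d₀ n (node d ρ) Q = height d ≤ n × ∃ λ x → Q ≡ child d ρ x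

  R₀ R : (n p q : ℕ) → Set
  R₀ n p q = Σ (ℕ × D) λ (k , d₀) → Σ (Pos × Pos) λ (P , Q) →
    (n ≡ pr k (encD d₀) × p ≡ code P × q ≡ code Q) × Child d₀ n P Q
  R n p q = ¬ ¬ R₀ n p q

  -- What a string s with first entry n must satisfy if its value at p is y.
  Rule : (s n p y : ℕ) → Set
  Rule s n p zero    = ∀ q z → Ent s (suc q) z → R n p q → z ≢ 0
  Rule s n p (suc q) = R n p q × (∀ z → Ent s (suc q) z → z ≡ 0) ×
                       (∀ q′ z → q′ < q → Ent s (suc q′) z → R n p q′ → z ≢ 0)

  Tree : ℕ → Set
  Tree s = Str s × (∀ n p y → Ent s 0 n → Ent s (suc p) y → Rule s n p y)

  -- Tags 0 and 1 let `mem` express the atomic formulas `≐` and `≺`, tag 2 makes the tree a set of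
  -- the model, and tag 3 supplies the edges from which its paths are defined.
  Fact : (tag body : ℕ) → Set
  Fact 0 b = ∃ λ x → b ≡ pr x x
  Fact 1 b = Σ (ℕ × ℕ) λ (x , y) → b ≡ pr x y × x < y
  Fact 2 s = Tree s
  Fact 3 b = Σ (ℕ × ℕ × ℕ) λ (n , p , q) → b ≡ pr n (pr p q) × R n p q
  Fact _ b = Empty

  Facts : ℕ → Set
  Facts v = Σ (ℕ × ℕ) λ (t , b) → v ≡ pr b t × Fact t b

-- Locality of facts and the fixed point `B`.

Local : (X Y : ℕ → Set) → ℕ → Set
Local X Y m = ∀ u → u < m → X u ⟺ Y u

Local-sym : ∀ {X Y m} → Local X Y m → Local Y X m
Local-sym e u lt = let f , g = e u lt in g , f

Local-≤ : ∀ {X Y m n} → m ≤ n → Local X Y n → Local X Y m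
Local-≤ m≤n e u u<m = e u (ℕ.<-≤-trans u<m m≤n)

Child-local : ∀ {X Y d₀ n} P {Q} → Local X Y (code P) → Child X d₀ n P Q → Child Y d₀ n P Q
Child-local (root x)   e c       = c
Child-local (leaf v)   e (c , a) = c , proj₁ (e v (leaf-code> v)) a
Child-local (node d ρ) e c       = c

R-local : ∀ {X Y n p q} → Local X Y p → R X n p q → R Y n p q
R-local e h = h >>= λ { (kd , (P , Q) , (a , refl , c) , ch) k →
  k (kd , (P , Q) , (a , refl , c) , Child-local P e ch) }

Rule-local : ∀ {X Y s n p} y → Local X Y s → p < s → Rule X s n p y → Rule Y s n p y
Rule-local zero    e p<s h q z ent r =
  h q z ent (R-local (Local-≤ (ℕ.<⇒≤ p<s) (Local-sym e)) r)
Rule-local (suc q) e p<s (r , h , h′) =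
  R-local (Local-≤ (ℕ.<⇒≤ p<s) e) r , h ,
  λ q′ z lt ent r → h′ q′ z lt ent (R-local (Local-≤ (ℕ.<⇒≤ p<s) (Local-sym e)) r)

Tree-local : ∀ {X Y s} → Local X Y s → Tree X s → Tree Y s
Tree-local e (str , h) =
  str , λ n p y e₀ e₁ → Rule-local y e (ℕ.<⇒≤ (Ent⇒< {i = suc p} {y} e₁)) (h n p y e₀ e₁)

Fact-local : ∀ {X Y} t {b} → Local X Y (pr b t) → Fact X t b → Fact Y t b
Fact-local 0 e h = h
Fact-local 1 e h = h
Fact-local 2 {s} e h = Tree-local (Local-≤ (x≤pr s 2) e) h
Fact-local 3 e ((n , p , q) , refl , r) =
  (n , p , q) , refl ,
  R-local (Local-≤ (ℕ.≤-trans (x≤pr p q) (ℕ.≤-trans (y≤pr n _) (x≤pr (pr n (pr p q)) 3))) e) r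

Facts-local : ∀ {X Y v} → Local X Y v → Facts X v → Facts Y v
Facts-local e ((t , b) , refl , h) = (t , b) , refl , Fact-local t e h

-- Facts X at v depends on X below v only, so Facts has a fixed point: the fuel
-- f in Fuelled f v is irrelevant as soon as it exceeds v.
Fuelled : ℕ → ℕ → Set
Fuelled zero    v = Empty
Fuelled (suc f) v = ¬ ¬ Facts (Fuelled f) v

fuel-irrelevant : ∀ f g {v} → v < f → v < g → Fuelled f v → Fuelled g v
fuel-irrelevant (suc f) (suc g) {v} v<f v<g h = h >>= λ a k →
  k (Facts-local (λ u u<v →
      let u<f = ℕ.<-≤-trans u<v (ℕ.≤-pred v<f)
          u<g = ℕ.<-≤-trans u<v (ℕ.≤-pred v<g) in
      fuel-irrelevant f g u<f u<g , fuel-irrelevant g f u<g u<f) a)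

opaque
  B : ℕ → Set
  B v = Fuelled (suc v) v

  B-fixed : ∀ v → B v ⟺ (¬ ¬ Facts B v)
  B-fixed v = (λ h → h >>= λ a k → k (Facts-local below a)) ,
              (λ h → h >>= λ a k → k (Facts-local (Local-sym below) a))
    where
    below : Local (Fuelled v) B v
    below u u<v = fuel-irrelevant v (suc u) u<v ℕ.≤-refl , fuel-irrelevant (suc u) v ℕ.≤-refl u<v

  B-stable : ∀ v → Stable (B v)
  B-stable v = negated-stable

Rule-stable : ∀ {X s n p} y → Stable (Rule X s n p y)
Rule-stable zero    h q z e r z≡0 = h λ u → u q z e r z≡0
Rule-stable (suc q) h =
  (λ k → h λ u → proj₁ u k) ,
  (λ z e → decidable-stable (z ℕ.≟ 0) λ k → h λ u → k (proj₁ (proj₂ u) z e)) ,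
  (λ q′ z lt e r z≡0 → h λ u → proj₂ (proj₂ u) q′ z lt e r z≡0)

-- `B` records facts only up to double negation; stability recovers the tree itself in `B-Tree`.
Tree-stable : ∀ {X s} → Stable (Tree X s)
Tree-stable h = (λ k → h λ u → proj₁ u k) ,
  λ n p y e₀ e₁ → Rule-stable y λ k → h λ u → k (proj₂ u n p y e₀ e₁)

B-pr : ∀ t b → B (pr b t) ⟺ (¬ ¬ Fact B t b)
B-pr t b = to , λ h → proj₂ (B-fixed _) λ k → h λ a → k ((t , b) , refl , a)
  where
  untag : Facts B (pr b t) → Fact B t b
  untag ((t′ , b′) , e , a) with pr-injective {b} {t} {b′} {t′} e
  ... | refl , refl = a
  to : B (pr b t) → ¬ ¬ Fact B t b
  to h k = proj₁ (B-fixed _) h (k ∘ untag)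

B-≡ : ∀ x y → B (pr (pr x y) 0) ⟺ (x ≡ y)
B-≡ x y =
  (λ b → decidable-stable (x ℕ.≟ y) λ k → proj₁ (B-pr 0 _) b λ { (z , e) →
    let x≡z , y≡z = pr-injective {x} {y} {z} {z} e in k (trans x≡z (sym y≡z)) }) ,
  λ { refl → proj₂ (B-pr 0 (pr x x)) λ k → k (x , refl) }

B-< : ∀ x y → B (pr (pr x y) 1) ⟺ (x < y)
B-< x y =
  (λ b → decidable-stable (x ℕ.<? y) λ k → proj₁ (B-pr 1 _) b λ { ((x′ , y′) , e , lt) →
    k (recover e lt) }) ,
  λ lt → proj₂ (B-pr 1 (pr x y)) λ k → k (_ , refl , lt)
  where
  recover : ∀ {x′ y′} → pr x y ≡ pr x′ y′ → x′ < y′ → x < y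
  recover {x′} {y′} e lt with refl , refl ← pr-injective {x} {y} {x′} {y′} e = lt

B-Tree : ∀ s → B (pr s 2) ⟺ Tree B s
B-Tree s = (λ b → Tree-stable (proj₁ (B-pr 2 s) b)) , λ t → proj₂ (B-pr 2 s) λ k → k t

B-R : ∀ n p q → B (pr (pr n (pr p q)) 3) ⟺ R B n p q
B-R n p q =
  (λ b k → proj₁ (B-pr 3 _) b λ { ((n′ , p′ , q′) , e , r) → recover e r k }) ,
  λ r → proj₂ (B-pr 3 (pr n (pr p q))) λ k → k (_ , refl , r)
  where
  recover : ∀ {n′ p′ q′} → pr n (pr p q) ≡ pr n′ (pr p′ q′) → R B n′ p′ q′ → R B n p q
  recover {n′} {p′} {q′} e r
    with refl , e′ ← pr-injective {n} {pr p q} {n′} {pr p′ q′} e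
    with refl , refl ← pr-injective {p} {q} {p′} {q′} e′ = r

-- The model

⟦_⟧ : D → List ℕ → Set
⟦ mem t ⟧      ρ = B (ev t ρ)
⟦ nor a b ⟧    ρ = ¬ ⟦ a ⟧ ρ × ¬ ⟦ b ⟧ ρ
⟦ none a ⟧     ρ = ∀ x → ¬ ⟦ a ⟧ (x ∷ ρ)
⟦ nclo t a σ ⟧ ρ = ¬ ⟦ a ⟧ (ev t ρ ∷ σ)

⟦⟧-stable : ∀ d ρ → Stable (⟦ d ⟧ ρ)
⟦⟧-stable (mem t)      ρ   = B-stable (ev t ρ)
⟦⟧-stable (nor a b)    ρ h = (λ x → h λ u → proj₁ u x) , (λ x → h λ u → proj₂ u x)
⟦⟧-stable (none a)     ρ h x y = h λ u → u x y
⟦⟧-stable (nclo t a σ) ρ h x   = h λ u → u x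

_∋_ : D → ℕ → Set
X ∋ x = ⟦ X ⟧ (x ∷ [])

open Semantics D _∋_ (λ X x → ⟦⟧-stable X (x ∷ [])) public

-- The graph of each level and its kernel.

Edge : (n p q : ℕ) → Set
Edge = R B

module _ (n : ℕ) where

  -- Bounds the length of paths of edges from `p` by `j`.
  Depth : ℕ → ℕ → Set
  Depth zero    p = ∀ q → ¬ Edge n p q
  Depth (suc j) p = ∀ q → Edge n p q → Depth j q

  -- Iterates, from the full set, of the operation whose fixed point is the kernel.
  V : ℕ → ℕ → Set
  V zero    p = Unit
  V (suc j) p = ∀ q → Edge n p q → ¬ V j q

  -- The kernel of the graph Edge n.
  W : ℕ → Set
  W = V (4 + n)

  Depth-stable : ∀ j p → Stable (Depth j p)
  Depth-stable zero    p h q r = h λ u → u q r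
  Depth-stable (suc j) p h q r = Depth-stable j q λ k → h λ u → k (u q r)

  Depth-suc : ∀ j p → Depth j p → Depth (suc j) p
  Depth-suc zero    p h q r = Empty-elim (h q r)
  Depth-suc (suc j) p h q r = Depth-suc j q (h q r)

  Depth-≤ : ∀ {i j} p → i ≤ j → Depth i p → Depth j p
  Depth-≤ {zero}  {zero}  p _       h   = h
  Depth-≤ {zero}  {suc j} p _       h q r = Empty-elim (h q r)
  Depth-≤ {suc i} {suc j} p (s≤s l) h q r = Depth-≤ q l (h q r)

  -- Each step to a successor lowers the depth and both indices by one, so the iterates no longer
  -- change at `p` beyond its depth. As `depth` bounds all depths by 3 + n, the index 4 + n is large
  -- enough for `W`.
  V-agree : ∀ j {p} → Depth j p → ∀ a b → j < a → j < b → V a p → V b p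
  V-agree zero    dp (suc a) (suc b) _ _ h q r = Empty-elim (dp q r)
  V-agree (suc j) dp (suc a) (suc b) (s≤s l) (s≤s l′) h q r v =
    h q r (V-agree j (dp q r) b a l′ l v)

  Successor : Pos → ℕ → Set
  Successor P q = Σ (ℕ × D) λ (k , d₀) → ∃ λ Q →
                  (n ≡ pr k (encD d₀) × q ≡ code Q) × Child B d₀ n P Q

  successor : ∀ P {q} → Edge n (code P) q → ¬ ¬ Successor P q
  successor P {q} h = h >>= λ { (kd , (P′ , Q) , (a , b , c) , ch) k →
    k (kd , Q , (a , c) , subst (λ P → Child B (proj₂ kd) n P Q) (sym (code-injective P P′ b)) ch) }

  Depth-top : Depth 0 (code top)
  Depth-top q r = successor top r λ ()

  Depth-leaf : ∀ v → Depth 1 (code (leaf v))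
  Depth-leaf v q r = Depth-stable 0 q λ k → successor (leaf v) r λ
    { (_ , _ , (_ , refl) , refl , _) → k Depth-top }

  -- Counting `mem` as height 1 accounts for the edge from its leaf to `top`.
  Depth-node : ∀ d ρ → Depth (suc (height d)) (code (node d ρ))
  Depth-node d ρ q r = Depth-stable (height d) q λ k → successor (node d ρ) r λ
    { (_ , _ , (_ , refl) , _ , x , refl) → k (child-depth d ρ x) }
    where
    child-depth : ∀ d ρ x → Depth (height d) (code (child d ρ x))
    child-depth (mem t)      ρ x       = Depth-leaf (ev t ρ)
    child-depth (nor a b)    ρ zero    =
      Depth-≤ (code (node a ρ)) (s≤s (ℕ.m≤m⊔n (height a) (height b))) (Depth-node a ρ)
    child-depth (nor a b)    ρ (suc x) =
      Depth-≤ (code (node b ρ)) (s≤s (ℕ.m≤n⊔m (height a) (height b))) (Depth-node b ρ)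
    child-depth (none a)     ρ x       = Depth-node a (x ∷ ρ)
    child-depth (nclo t a σ) ρ x       = Depth-node a (ev t ρ ∷ σ)

  -- A node of height above `n` has no successors; for the others `Depth-node` gives the bound.
  Depth-any-node : ∀ d ρ → Depth (2 + n) (code (node d ρ))
  Depth-any-node d ρ q r = Depth-stable (1 + n) q λ k → successor (node d ρ) r λ
    { (_ , _ , _ , le , _) → k (Depth-≤ q (ℕ.≤-trans le (ℕ.n≤1+n n)) (Depth-node d ρ q r)) }

  depth : ∀ p → Depth (3 + n) p
  depth p q r = Depth-stable (2 + n) q λ k → r λ
    { (_ , (root x   , _) , (_ , refl , refl) , refl)     → k (Depth-any-node _ _)
    ; (_ , (leaf v   , _) , (_ , refl , refl) , refl , _) →
        k (Depth-≤ {0} {2 + n} (code top) z≤n Depth-top)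
    ; (_ , (node d ρ , _) , (_ , refl , refl) , ch)       →
        k (Depth-suc (1 + n) q (Depth-any-node d ρ q r)) }

  -- A successor of `p` has depth at most 2 + n, so the iterates 3 + n and 4 + n agree there.
  kernel : ∀ p → W p ⟺ (∀ q → Edge n p q → ¬ W q)
  kernel p =
    (λ h q r v → h q r (V-agree (2 + n) (depth p q r) (4 + n) (3 + n) (s≤s (ℕ.n≤1+n _)) ℕ.≤-refl v)) ,
    (λ h q r v → h q r (V-agree (2 + n) (depth p q r) (3 + n) (4 + n) ℕ.≤-refl (s≤s (ℕ.n≤1+n _)) v))

  W-stable : ∀ p → Stable (W p)
  W-stable p h q r v = h λ u → u q r v

  W-top : W (code top)
  W-top q r = Empty-elim (Depth-top q r)

module _ (k : ℕ) (d₀ : D) where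

  private
    n = pr k (encD d₀)

  edge : ∀ P Q → Child B d₀ n P Q → Edge n (code P) (code Q)
  edge P Q c k′ = k′ ((k , d₀) , (P , Q) , (refl , refl , refl) , c)

  W-leaf : ∀ v → W n (code (leaf v)) ⟺ (¬ B v)
  W-leaf v =
    (λ w b → proj₁ (kernel n _) w _ (edge (leaf v) top (refl , b)) (W-top n)) ,
    (λ ¬b → proj₂ (kernel n (code (leaf v))) λ q r _ → successor n (leaf v) r λ
      { (_ , _ , _ , _ , b) → ¬b b })

  W-node : ∀ d ρ → height d ≤ n →
           W n (code (node d ρ)) ⟺ (∀ x → ¬ W n (code (child d ρ x)))
  W-node d ρ le =
    (λ w x → proj₁ (kernel n _) w _ (edge (node d ρ) (child d ρ x) (le , x , refl))) ,
    (λ h → proj₂ (kernel n (code (node d ρ))) λ q r w → successor n (node d ρ) r λ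
      { (_ , _ , (_ , refl) , _ , x , refl) → h x w })

  -- `nor`, `none` and `nclo` deny all their children, just as membership in the kernel does. For
  -- `mem t` two negations cancel: its leaf is in the kernel if and only if the fact fails.
  W-⟦⟧ : ∀ d ρ → height d ≤ n → W n (code (node d ρ)) ⟺ ⟦ d ⟧ ρ
  W-⟦⟧ (mem t) ρ le = ⟺-trans (W-node (mem t) ρ le)
    ( (λ h → B-stable (ev t ρ) λ ¬b → h 0 (proj₂ (W-leaf _) ¬b))
    , (λ b x w → proj₁ (W-leaf _) w b))
  W-⟦⟧ (nor a b) ρ le = ⟺-trans (W-node (nor a b) ρ le)
    ( (λ h → h 0 ∘ proj₂ a-correct , h 1 ∘ proj₂ b-correct)
    , (λ { (¬a , ¬b) zero → ¬a ∘ proj₁ a-correct ; (¬a , ¬b) (suc x) → ¬b ∘ proj₁ b-correct }))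
    where
    le′ : height a ⊔ height b ≤ n
    le′ = ℕ.<⇒≤ le
    a-correct = W-⟦⟧ a ρ (ℕ.≤-trans (ℕ.m≤m⊔n _ _) le′)
    b-correct = W-⟦⟧ b ρ (ℕ.≤-trans (ℕ.m≤n⊔m _ _) le′)
  W-⟦⟧ (none a) ρ le = ⟺-trans (W-node (none a) ρ le)
    (∀-cong λ x → ¬-cong (W-⟦⟧ a (x ∷ ρ) (ℕ.<⇒≤ le)))
  W-⟦⟧ (nclo t a σ) ρ le = ⟺-trans (W-node (nclo t a σ) ρ le)
    ( (λ h → h 0 ∘ proj₂ a-correct) , (λ h x → h ∘ proj₁ a-correct))
    where
    a-correct = W-⟦⟧ a (ev t ρ ∷ σ) (ℕ.<⇒≤ le)

  -- The level determines `d₀` by `encD-injective`, so `root x` has a single successor.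
  W-root : ∀ x → W n (code (root x)) ⟺ (¬ W n (code (node d₀ (x ∷ []))))
  W-root x =
    (λ w → proj₁ (kernel n _) w _ (edge (root x) (node d₀ (x ∷ [])) refl)) ,
    (λ h → proj₂ (kernel n (code (root x))) λ q r w → successor n (root x) r λ
      { ((k′ , _) , _ , (e , refl) , refl) → recover {k′} e h w })
    where
    recover : ∀ {k′ d′} → n ≡ pr k′ (encD d′) → ¬ W n (code (node d₀ (x ∷ []))) →
              ¬ W n (code (node d′ (x ∷ [])))
    recover {k′} {d′} e h w
      with refl ← encD-injective d₀ d′ (pr-injective₂ {k} {_} {k′} e) = h w

-- Arithmetical comprehension.

neg : D → D
neg d = nor d d

imp : D → D → D
imp a b = neg (nor (neg a) b)

prT : Tm → Tm → Tm
prT s t = add (mul (add s t) (add s t)) s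

tm : ∀ {n} → Term n → Tm
tm (var i) = var (toℕ i)
tm 𝟘       = con 0
tm 𝟙       = con 1
tm (s ⊕ t) = add (tm s) (tm t)
tm (s ⊗ t) = mul (tm s) (tm t)

translate : ∀ {m n} → (Fin m → D) → Formula m n → D
translate μ (s ≐ t) = mem (prT (prT (tm s) (tm t)) (con 0))
translate μ (s ≺ t) = mem (prT (prT (tm s) (tm t)) (con 1))
-- The empty list in the closure leaves the value of `t` as the only entry of the environment, as in
-- `_∋_`; `neg` cancels the denial in `nclo`.
translate μ (t ϵ X) = neg (nclo (tm t) (μ X) [])
translate μ ⊥       = mem (prT (prT (con 0) (con 1)) (con 0))
translate μ (φ ∧ ψ) = nor (neg (translate μ φ)) (neg (translate μ ψ))
translate μ (φ ∨ ψ) = neg (nor (translate μ φ) (translate μ ψ))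
translate μ (φ ⇒ ψ) = imp (translate μ φ) (translate μ ψ)
translate μ (∀ᴺ φ)  = none (neg (translate μ φ))
translate μ (∃ᴺ φ)  = neg (none (translate μ φ))
-- Default values; `⟦translate⟧` concerns arithmetical formulas.
translate μ (∀ˢ φ)  = mem (con 0)
translate μ (∃ˢ φ)  = mem (con 0)

ev-tm : ∀ {n} (t : Term n) {ν ρ} → (∀ i → nth ρ (toℕ i) ≡ ν i) → ev (tm t) ρ ≡ ⟦ t ⟧ᵗ ν
ev-tm (var i) e = e i
ev-tm 𝟘       e = refl
ev-tm 𝟙       e = refl
ev-tm (s ⊕ t) e = cong₂ _+_ (ev-tm s e) (ev-tm t e)
ev-tm (s ⊗ t) e = cong₂ _*_ (ev-tm s e) (ev-tm t e)

⟦neg⟧ : ∀ d ρ {A : Set} → ⟦ d ⟧ ρ ⟺ A → ⟦ neg d ⟧ ρ ⟺ (¬ A)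
⟦neg⟧ d ρ e = (λ h → proj₁ (¬-cong e) (proj₁ h)) , (λ h → let u = proj₂ (¬-cong e) h in u , u)

⟦translate⟧ : ∀ {m n} (μ : Fin m → D) (φ : Formula m n) → Arithmetical φ →
              ∀ {ν ρ} → (∀ i → nth ρ (toℕ i) ≡ ν i) → ⟦ translate μ φ ⟧ ρ ⟺ Sat φ μ ν
⟦translate⟧ μ (s ≐ t) ar e rewrite sym (ev-tm s e) | sym (ev-tm t e) = B-≡ _ _
⟦translate⟧ μ (s ≺ t) ar e rewrite sym (ev-tm s e) | sym (ev-tm t e) = B-< _ _
⟦translate⟧ μ (t ϵ X) ar {ρ = ρ} e rewrite sym (ev-tm t e) =
  (λ h → ⟦⟧-stable (μ X) _ (proj₁ h)) , λ a → (λ k → k a) , (λ k → k a)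
⟦translate⟧ μ ⊥ ar e = (λ b → 0≢1 (proj₁ (B-≡ 0 1) b)) , λ ()
  where
  0≢1 : 0 ≢ 1
  0≢1 ()
⟦translate⟧ μ (φ ∧ ψ) (arφ , arψ) {ν} {ρ} e =
  ⟺-trans (×-cong (¬-cong (⟦neg⟧ (translate μ φ) ρ (⟦translate⟧ μ φ arφ e)))
                  (¬-cong (⟦neg⟧ (translate μ ψ) ρ (⟦translate⟧ μ ψ arψ e))))
          ( (λ (a , b) → stable φ _ _ a , stable ψ _ _ b)
          , (λ (a , b) → (λ k → k a) , (λ k → k b)))
⟦translate⟧ μ (φ ∨ ψ) (arφ , arψ) {ρ = ρ} e =
  ⟦neg⟧ (nor (translate μ φ) (translate μ ψ)) ρ
    (×-cong (¬-cong (⟦translate⟧ μ φ arφ e)) (¬-cong (⟦translate⟧ μ ψ arψ e)))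
⟦translate⟧ μ (φ ⇒ ψ) (arφ , arψ) {ρ = ρ} e =
  ⟺-trans (⟦neg⟧ (nor (neg (translate μ φ)) (translate μ ψ)) ρ
            (×-cong (¬-cong (⟦neg⟧ (translate μ φ) ρ (⟦translate⟧ μ φ arφ e)))
                            (¬-cong (⟦translate⟧ μ ψ arψ e))))
          ( (λ h a → stable ψ _ _ λ ¬b → h ((λ ¬a → ¬a a) , ¬b))
          , (λ h (¬¬a , ¬b) → ¬¬a (¬b ∘ h)))
⟦translate⟧ μ (∀ᴺ φ) ar {ρ = ρ} e =
  ⟺-trans (∀-cong λ x → ¬-cong (⟦neg⟧ (translate μ φ) (x ∷ ρ)
            (⟦translate⟧ μ φ ar λ { zero → refl ; (suc i) → e i })))
          ((λ h x → stable φ _ _ (h x)) , (λ h x k → k (h x)))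
⟦translate⟧ μ (∃ᴺ φ) ar {ρ = ρ} e =
  ⟦neg⟧ (none (translate μ φ)) ρ
    (∀-cong λ x → ¬-cong (⟦translate⟧ μ φ ar λ { zero → refl ; (suc i) → e i }))

nth-tabulate : ∀ {n} (ν : Fin n → ℕ) i → nth (tabulate ν) (toℕ i) ≡ ν i
nth-tabulate ν zero    = refl
nth-tabulate ν (suc i) = nth-tabulate (ν ∘ suc) i

opaque
  comprehension-holds : Comprehension
  comprehension-holds φ ar μ ν =
    -- The closure stores the number parameters, and `var 0` puts the element in front of them.
    neg (nclo (var 0) (translate μ φ) (tabulate ν)) ,
    λ x → ⟺-trans
      ((λ h → ⟦⟧-stable (translate μ φ) _ (proj₁ h)) , λ a → (λ k → k a) , (λ k → k a))
      (⟦translate⟧ μ φ ar λ { zero → refl ; (suc i) → nth-tabulate ν i })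

-- Strings and the paths of the tree

modulus : (b i : ℕ) → ℕ
modulus b i = suc ((i + 1) * b)

Bet⇒% : ∀ {a b i v} → Bet a b i v → v ≡ a % modulus b i
Bet⇒% {a} {b} {i} {v} (v<m , h) =
  decidable-stable (v ℕ.≟ _) λ k → h λ { q refl → k (sym (remainder q)) }
  where
  remainder : ∀ q → (q * modulus b i + v) % modulus b i ≡ v
  remainder q = trans (cong (_% modulus b i) (ℕ.+-comm (q * modulus b i) v))
                  (trans ([m+kn]%n≡m%n v q (modulus b i)) (m<n⇒m%n≡m v<m))

%⇒Bet : ∀ a b i → Bet a b i (a % modulus b i)
%⇒Bet a b i = m%n<n a (modulus b i) ,
  ex (a / modulus b i) (trans (m≡m%n+[m/n]*n a (modulus b i))
    (ℕ.+-comm (a % modulus b i) (a / modulus b i * modulus b i)))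

Ent-intro : ∀ l a b {i v} → i < l → Bet a b i v → Ent (pr l (pr a b)) i v
Ent-intro l a b i<l bet = ex l (ex a (ex b (refl , i<l , bet)))

Ent-elim : ∀ l a b {i v} → Ent (pr l (pr a b)) i v → i < l × v ≡ a % modulus b i
Ent-elim l a b {i} {v} h =
  decidable-stable (i ℕ.<? l) (λ k → go (k ∘ proj₁)) ,
  decidable-stable (v ℕ.≟ a % modulus b i) (λ k → go (k ∘ proj₂))
  where
  go : ¬ ¬ (i < l × v ≡ a % modulus b i)
  go k = h λ l′ h → h λ a′ h → h λ b′ (e , i<l , bet) → k (recover e i<l bet)
    where
    recover : ∀ {l′ a′ b′} → pr l (pr a b) ≡ pr l′ (pr a′ b′) → i < l′ → Bet a′ b′ i v →
              i < l × v ≡ a % modulus b i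
    recover {l′} {a′} {b′} e i<l bet
      with refl , e′ ← pr-injective {l} {pr a b} {l′} {pr a′ b′} e
      with refl , refl ← pr-injective {a} {b} {a′} {b′} e′ = i<l , Bet⇒% {a} {b} {i} bet

Ent⇒Str : ∀ {s i v} → Ent s i v → ¬ ¬ (Σ (ℕ × ℕ × ℕ) λ (l , a , b) → s ≡ pr l (pr a b))
Ent⇒Str h k = h λ l h → h λ a h → h λ b (e , _) → k ((l , a , b) , e)

Ent-functional : ∀ {s i v w} → Ent s i v → Ent s i w → v ≡ w
Ent-functional {s} {i} {v} {w} h h′ = decidable-stable (v ℕ.≟ w) λ k → Ent⇒Str h λ
  { ((l , a , b) , refl) → k (trans (proj₂ (Ent-elim l a b h)) (sym (proj₂ (Ent-elim l a b h′)))) }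

-- Every index below the length has an entry, namely a remainder, so the domain of a string is an
-- initial segment.
Ent-below : ∀ {s i j v} → Ent s i v → j ≤ i → ¬ ¬ (∃ λ w → Ent s j w)
Ent-below {j = j} h j≤i k = Ent⇒Str h λ
  { ((l , a , b) , refl) →
      k (_ , Ent-intro l a b (ℕ.≤-<-trans j≤i (proj₁ (Ent-elim l a b h))) (%⇒Bet a b j)) }

Prefix : ℕ → ℕ → Set
Prefix s t = ∀ i v → Ent s i v → Ent t i v

Prefix-trans : ∀ {s t u} → Prefix s t → Prefix t u → Prefix s u
Prefix-trans p q i v = q i v ∘ p i v

module _ (n : ℕ) where

  -- The values of the only path of the tree through the node ⟨n⟩.
  Val : ℕ → ℕ → Set
  Val p zero    = W n p
  Val p (suc q) = Edge n p q × W n q × (∀ q′ → q′ < q → Edge n p q′ → ¬ W n q′)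

  Val-zero : ∀ {p y} → W n p → Val p y → y ≡ 0
  Val-zero {y = zero}  w v       = refl
  Val-zero {p} {suc q} w (e , v , _) = Empty-elim (proj₁ (kernel n p) w q e v)

  Val-functional : ∀ {p y z} → Val p y → Val p z → y ≡ z
  Val-functional {p} {zero} {z} v v′ = sym (Val-zero {p} {z} v v′)
  Val-functional {p} {suc y} {zero} v v′ = Val-zero {p} {suc y} v′ v
  Val-functional {y = suc y} {suc z} (e , w , least) (e′ , w′ , least′) with ℕ.<-cmp y z
  ... | tri< lt _ _   = Empty-elim (least′ y lt e w)
  ... | tri≈ _ refl _ = refl
  ... | tri> _ _ gt   = Empty-elim (least z gt e′ w′)

  -- If no `suc q` is a value, strong induction shows that no successor of `p` is in the kernel;
  -- then `p` is in the kernel and 0 is a value.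
  Val-total : ∀ p → ¬ ¬ ∃ (Val p)
  Val-total p k = k (0 , proj₂ (kernel n p)
    (<-rec (λ q → Edge n p q → ¬ W n q) λ q ih e w → k (suc q , e , w , λ q′ lt → ih lt)))

  Val-stable : ∀ p y → Stable (Val p y)
  Val-stable p zero    h = W-stable n p h
  Val-stable p (suc q) h = (λ k → h λ u → proj₁ u k) ,
    W-stable n q (λ k → h λ u → k (proj₁ (proj₂ u))) ,
    λ q′ lt e w → h λ u → proj₂ (proj₂ u) q′ lt e w

  Graph : ℕ → ℕ → Set
  Graph zero    y = y ≡ n
  Graph (suc p) y = Val p y

  Graph-functional : ∀ i {y z} → Graph i y → Graph i z → y ≡ z
  Graph-functional zero    refl refl = refl
  Graph-functional (suc p) {y} {z} v v′ = Val-functional {p} {y} {z} v v′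

  Graph-total : ∀ i → ¬ ¬ ∃ (Graph i)
  Graph-total zero    k = k (n , refl)
  Graph-total (suc p) k = Val-total p k

  Graph-stable : ∀ i y → Stable (Graph i y)
  Graph-stable zero    y = decidable-stable (y ℕ.≟ n)
  Graph-stable (suc p) y = Val-stable p y

  follows⇒Rule : ∀ {s p} y → (∀ i v → Ent s i v → Graph i v) → Val p y → Rule B s n p y
  follows⇒Rule {p = p} zero f w q z ent e refl = proj₁ (kernel n p) w q e (f _ _ ent)
  follows⇒Rule (suc q) f (e , w , least) =
    e , (λ z ent → Val-zero {q} {z} w (f _ z ent)) ,
    λ { q′ z lt ent e′ refl → least q′ lt e′ (f _ _ ent) }

  follows⇒Tree : ∀ {s} → Str s → (∀ i v → Ent s i v → Graph i v) → Tree B s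
  follows⇒Tree {s} str f = str , λ n′ p y e₀ e₁ →
    subst (λ n → Rule B s n p y) (sym (f 0 n′ e₀)) (follows⇒Rule {s} {p} y f (f (suc p) y e₁))

-- Entries of the string occur in `Rule` only as hypotheses, so the rule passes to shorter strings.
Rule-prefix : ∀ {s t n p} y → Prefix t s → Rule B s n p y → Rule B t n p y
Rule-prefix zero    pre h q z ent = h q z (pre _ _ ent)
Rule-prefix (suc q) pre (e , h , h′) =
  e , (λ z ent → h z (pre _ _ ent)) , (λ q′ z lt ent → h′ q′ z lt (pre _ _ ent))

Tree-prefix : ∀ {s t} → Tree B s → Str t → Prefix t s → Tree B t
Tree-prefix (_ , h) str pre =
  str , λ n p y e₀ e₁ → Rule-prefix y pre (h n p y (pre _ _ e₀) (pre _ _ e₁))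

-- The tree has no perfect subtree

module PerfectSubtree
  (P : ℕ → Set)
  (P⊆Tree : ∀ s → P s → Tree B s)
  (nonempty : ¬ ¬ ∃ P)
  (splitting : ∀ s → P s → ¬ ¬ (Σ (ℕ × ℕ) λ (t , u) →
     (P t × Prefix s t) × (P u × Prefix s u) × ¬ Prefix t u × ¬ Prefix u t))
  where

  -- Induction on `m`: an extension `t` with entries below `m` has incompatible extensions `u` and
  -- `u′`. If `u` had no entry at `m`, all its entries would already be entries of `t`, making `u` a
  -- prefix of `u′`.
  extension : ∀ m s → P s → ¬ ¬ (∃ λ t → P t × Prefix s t × (∀ i → i < m → ¬ ¬ (∃ (Ent t i))))
  extension zero    s s∈P k = k (s , s∈P , (λ _ _ → id) , λ _ ())
  extension (suc m) s s∈P k =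
    extension m s s∈P λ { (t , t∈P , s⊑t , long) →
    splitting t t∈P λ { ((u , u′) , (u∈P , t⊑u) , (_ , t⊑u′) , u⋢u′ , _) →
    ¬¬-excluded-middle {A = ∃ (Ent u m)} λ
      { (yes has-m) → k (u , u∈P , Prefix-trans {s} {t} {u} s⊑t t⊑u , λ i i<1+m →
          λ k → longer t⊑u long has-m i i<1+m k)
      ; (no no-m) → u⋢u′ λ i v ent → Ent-stable u′ i v λ k →
          long i (ℕ.≰⇒> λ m≤i → Ent-below ent m≤i no-m) λ (w , ent′) →
          k (subst (Ent u′ i) (Ent-functional (t⊑u i w ent′) ent) (t⊑u′ i w ent′)) } } }
    where
    Ent-stable : ∀ s i v → Stable (Ent s i v)
    Ent-stable s i v = negated-stable
    longer : ∀ {t u} → Prefix t u → (∀ i → i < m → ¬ ¬ ∃ (Ent t i)) → ∃ (Ent u m) →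
             ∀ i → i < suc m → ¬ ¬ ∃ (Ent u i)
    longer t⊑u long has-m i i<1+m k with ℕ.m≤n⇒m<n∨m≡n (ℕ.≤-pred i<1+m)
    ... | inj₁ i<m  = long i i<m λ (w , ent) → k (w , t⊑u i w ent)
    ... | inj₂ refl = k has-m

  extension-at : ∀ m s → P s → ¬ ¬ (∃ λ t → P t × Prefix s t × ∃ (Ent t m))
  extension-at m s s∈P k = extension (suc m) s s∈P λ (t , t∈P , s⊑t , long) →
    long m ℕ.≤-refl λ has-m → k (t , t∈P , s⊑t , has-m)

  rule : ∀ {s n p y} → P s → Ent s 0 n → Ent s (suc p) y → Rule B s n p y
  rule s∈P = proj₂ (P⊆Tree _ s∈P) _ _ _

  -- Induction on the depth. The rule at `p` constrains the value at `q` only in strings long enough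
  -- to have one, so `s` is first extended inside `P`; in the extension the value at `q` is correct
  -- by induction, and the rule still speaks about the same `y`.
  forced : ∀ {n} j p → Depth n j p → ∀ {s y} → P s → Ent s 0 n → Ent s (suc p) y → Val n p y
  forced-successor : ∀ {n} j p → Depth n j p → ∀ {q s y} → Edge n p q →
                     P s → Ent s 0 n → Ent s (suc q) y → Val n q y
  forced-successor zero    p dp e = Empty-elim (dp _ e)
  forced-successor (suc j) p dp e = forced j _ (dp _ e)
  forced {n} j p dp {s} {zero} s∈P e₀ e₁ = proj₂ (kernel n p) λ q edge w →
    extension-at (suc q) s s∈P λ { (t , t∈P , s⊑t , z , ent) →
    rule t∈P (s⊑t _ _ e₀) (s⊑t _ _ e₁) q z ent edge
      (Val-zero n {q} {z} w (forced-successor j p dp edge t∈P (s⊑t _ _ e₀) ent)) }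
  forced {n} j p dp {s} {suc q} s∈P e₀ e₁ =
    pq ,
    W-stable n q (λ k → extension-at (suc q) s s∈P λ { (t , t∈P , s⊑t , z , ent) →
      k (subst (Val n q) (proj₁ (proj₂ (rule t∈P (s⊑t _ _ e₀) (s⊑t _ _ e₁))) z ent)
           (forced-successor j p dp pq t∈P (s⊑t _ _ e₀) ent)) }) ,
    λ q′ lt edge′ w → extension-at (suc q′) s s∈P λ { (t , t∈P , s⊑t , z , ent) →
      proj₂ (proj₂ (rule t∈P (s⊑t _ _ e₀) (s⊑t _ _ e₁))) q′ z lt ent edge′
        (Val-zero n {q′} {z} w (forced-successor j p dp edge′ t∈P (s⊑t _ _ e₀) ent)) }
    where
    pq : Edge n p q
    pq = proj₁ (rule s∈P e₀ e₁)

  follows : ∀ {n s} → P s → Ent s 0 n → ∀ i y → Ent s i y → Graph n i y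
  follows s∈P e₀ zero    y ent = Ent-functional ent e₀
  follows {n} s∈P e₀ (suc p) y ent = forced (3 + n) p (depth n p) s∈P e₀ ent

  -- If the prefix relations fail at `i` and `j`, both strings have an entry at the smaller index by
  -- `Ent-below`, and there both carry the value given by `Graph`, a contradiction.
  comparable : ∀ {n t u} → P t → P u → Ent t 0 n → Ent u 0 n → ¬ Prefix t u → ¬ ¬ Prefix u t
  comparable {n} {t} {u} t∈P u∈P et eu t⋢u k = t⋢u λ i v ent → negated-stable λ no-ent →
    k λ j w ent′ → negated-stable λ no-ent′ → compare i v ent no-ent j w ent′ no-ent′ (ℕ.≤-total i j)
    where
    agree : ∀ i {v w} → Ent t i v → Ent u i w → v ≡ w
    agree i e e′ = Graph-functional n i (follows t∈P et i _ e) (follows u∈P eu i _ e′)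
    compare : ∀ i v → Ent t i v → ¬ Ent u i v → ∀ j w → Ent u j w → ¬ Ent t j w →
              ¬ (i ≤ j ⊎ j ≤ i)
    compare i v e ¬e j w e′ ¬e′ (inj₁ i≤j) =
      Ent-below e′ i≤j λ (v′ , e″) → ¬e (subst (Ent u i) (sym (agree i e e″)) e″)
    compare i v e ¬e j w e′ ¬e′ (inj₂ j≤i) =
      Ent-below e j≤i λ (w′ , e″) → ¬e′ (subst (Ent t j) (agree j e″ e′) e″)

  impossible : Empty
  impossible =
    nonempty λ { (r , r∈P) →
    -- The first entry fixes the level; both strings of the next splitting inherit it.
    extension-at 0 r r∈P λ { (s , s∈P , _ , n , e₀) →
    splitting s s∈P λ { ((t , u) , (t∈P , s⊑t) , (u∈P , s⊑u) , t⋢u , u⋢t) →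
    comparable t∈P u∈P (s⊑t _ _ e₀) (s⊑u _ _ e₀) t⋢u u⋢t } } }

-- The tree and its paths as sets of the model.

factSet treeSet : D
factSet = mem (var 0)
treeSet = mem (prT (var 0) (con 2))

treeSet-∋ : ∀ s → (treeSet ∋ s) ⟺ Tree B s
treeSet-∋ = B-Tree

-- Set variable 0 stands for `factSet`, and 3 is the tag of the edge facts.
edgeF : ∀ {m k} → (n p q : Term k) → Formula (suc m) k
edgeF n p q = pair (pair n (pair p q)) (num 3) ϵ zero

-- Passes from one iterate `V n j`, as set variable 1, to the next; the free number variables are
-- the vertex and the level.
levelF : Formula 2 2
levelF = ∀ᴺ edgeF v₂ v₁ v₀ ⇒ ¬̇ v₀ ϵ suc zero

opaque
  -- Comprehension is applied once per iterate, which puts the kernel of each single level into the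
  -- model.
  levelSet : ∀ n j → ∃ λ X → ∀ p → (X ∋ p) ⟺ V n j p
  levelSet n zero = neg (mem (prT (prT (con 0) (con 1)) (con 0))) , λ p →
    (λ _ → tt) , (λ _ → let 0≢1 = λ b → ℕ.0≢1+n (proj₁ (B-≡ 0 1) b) in 0≢1 , 0≢1)
  levelSet n (suc j) =
    let X , hX = levelSet n j
        Y , hY = comprehension-holds levelF _ (inst factSet (inst X λ ())) (inst n λ ()) in
    Y , λ p → ⟺-trans (hY p) (∀-cong λ q → →-cong (B-R n p q) (¬-cong (hX q)))

-- Set variable 1 is the kernel of the level. The cases are the first entry, the value 0, and the
-- value 1 + q with `q` the least successor in the kernel.
graphF : Formula 2 2
graphF =
    v₀ ≐ pair 𝟘 v₁
  ∨ (∃ᴺ ∃ᴺ v₂ ≐ pair (v₁ ⊕ 𝟙) v₀ ∧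
      ( (v₀ ≐ 𝟘 ∧ v₁ ϵ suc zero)
      ∨ (∃ᴺ v₁ ≐ v₀ ⊕ 𝟙 ∧ edgeF v₄ v₂ v₀ ∧ v₀ ϵ suc zero ∧
          (∀ᴺ v₀ ≺ v₁ ⇒ edgeF v₅ v₃ v₀ ⇒ ¬̇ v₀ ϵ suc zero))))

GraphCode : ℕ → ℕ → Set
GraphCode n k = ¬ ¬ (Σ (ℕ × ℕ) λ (i , y) → k ≡ pr i y × Graph n i y)

GraphCode-pr : ∀ n i y → GraphCode n (pr i y) ⟺ Graph n i y
GraphCode-pr n i y =
  (λ h → Graph-stable n i y λ k → h λ ((j , z) , e , g) → k (recover {j} {z} e g)) ,
  λ g k → k ((i , y) , refl , g)
  where
  recover : ∀ {j z} → pr i y ≡ pr j z → Graph n j z → Graph n i y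
  recover {j} {z} e g with refl , refl ← pr-injective {i} {y} {j} {z} e = g

pr-suc : ∀ p y → pr (p + 1) y ≡ pr (suc p) y
pr-suc p y = cong (λ i → pr i y) (ℕ.+-comm p 1)

graphSet : ∀ n → ∃ λ F → ∀ k → (F ∋ k) ⟺ GraphCode n k
graphSet n = F , λ k → ⟺-trans (hF k) (to k , from k)
  where
  X : D
  X = proj₁ (levelSet n (4 + n))
  hX : ∀ p → (X ∋ p) ⟺ W n p
  hX = proj₂ (levelSet n (4 + n))
  μ : Fin 2 → D
  μ = inst factSet (inst X λ ())
  F = proj₁ (comprehension-holds graphF _ μ (inst n λ ()))
  hF = proj₂ (comprehension-holds graphF _ μ (inst n λ ()))
  to : ∀ k → Sat graphF μ (inst k (inst n λ ())) → GraphCode n k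
  to k h c = h
    ( (λ e → c ((0 , n) , e , refl))
    , (λ h → h λ p h → h λ y (e , h) → h
        ( (λ (y≡0 , w) → c ((suc p , y) , trans e (pr-suc p y) ,
             subst (Val n p) (sym y≡0) (proj₁ (hX p) w)))
        , (λ h → h λ q (y≡q+1 , edge , w , least) →
             c ((suc p , y) , trans e (pr-suc p y) ,
             subst (Val n p) (sym (trans y≡q+1 (ℕ.+-comm q 1))) 
               ( proj₁ (B-R n p q) edge , proj₁ (hX q) w
               , λ q′ lt edge′ w′ → least q′ lt (proj₂ (B-R n p q′) edge′) (proj₂ (hX q′) w′)))))))
  from : ∀ k → GraphCode n k → Sat graphF μ (inst k (inst n λ ()))
  from k h = stable graphF μ (inst k (inst n λ ())) λ c → h λ
    { ((zero , y) , e , refl) → c (λ u → proj₁ u e)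
    ; ((suc p , zero) , e , w) →
        c (λ u → proj₂ u (ex p (ex 0 (trans e (sym (pr-suc p 0)) ,
          λ u → proj₁ u (refl , proj₂ (hX p) w)))))
    ; ((suc p , suc q) , e , edge , w , least) →
        c (λ u → proj₂ u (ex p (ex (suc q) (trans e (sym (pr-suc p (suc q))) ,
          λ u → proj₂ u (ex q
          (ℕ.+-comm 1 q , proj₂ (B-R n p q) edge , proj₂ (hX q) w ,
           λ q′ lt edge′ w′ → least q′ lt (proj₁ (B-R n p q′) edge′) (proj₁ (hX q′) w′)))))))
    }

treeSet-isTree : ∀ {μ : Fin 0 → D} {ν : Fin 0 → ℕ} → Sat (IsTree zero) (inst treeSet μ) ν
treeSet-isTree =
  (λ s s∈T → proj₁ (proj₁ (treeSet-∋ s) s∈T)) ,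
  λ s t (s∈T , str , pre) → proj₂ (treeSet-∋ t) (Tree-prefix (proj₁ (treeSet-∋ s) s∈T) str pre)

graphSet-isPath : ∀ n X {μ : Fin 0 → D} {ν : Fin 0 → ℕ} →
  Sat (IsPath zero (suc (suc zero))) (inst (proj₁ (graphSet n)) (inst X (inst treeSet μ))) ν
graphSet-isPath n X = (isPairs , total , functional) , initial
  where
  F = proj₁ (graphSet n)
  F∋ : ∀ i y → (F ∋ pr i y) ⟺ Graph n i y
  F∋ i y = ⟺-trans (proj₂ (graphSet n) (pr i y)) (GraphCode-pr n i y)
  isPairs : ∀ k → F ∋ k → ¬ (∀ i → ¬ ¬ (∀ y → ¬ (k ≡ pr i y)))
  isPairs k k∈F c = proj₁ (proj₂ (graphSet n) k) k∈F λ ((i , y) , e , _) → c i λ c → c y e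
  total : ∀ i → ¬ (∀ y → ¬ (F ∋ pr i y))
  total i c = Graph-total n i λ (y , g) → c y (proj₂ (F∋ i y) g)
  functional : ∀ i y z → F ∋ pr i y × F ∋ pr i z → y ≡ z
  functional i y z (a , b) = Graph-functional n i (proj₁ (F∋ i y) a) (proj₁ (F∋ i z) b)
  initial : ∀ s → Str s × (∀ i v → Ent s i v → F ∋ pr i v) → treeSet ∋ s
  initial s (str , f) =
    proj₂ (treeSet-∋ s) (follows⇒Tree n str λ i v ent → proj₁ (F∋ i v) (f i v ent))

treeSet-noPerfect : ∀ {μ : Fin 0 → D} {ν : Fin 0 → ℕ} P →
  ¬ Sat (IsPerfectTree zero ∧ zero ⊆ suc zero) (inst P (inst treeSet μ)) ν
treeSet-noPerfect P ((_ , nonempty , splitting) , P⊆T) =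
  PerfectSubtree.impossible (P ∋_) (λ s s∈P → proj₁ (treeSet-∋ s) (P⊆T s s∈P))
    (λ k → nonempty λ s s∈P → k (s , s∈P))
    (λ s s∈P k → splitting s s∈P λ t h → h λ u a → k ((t , u) , a))

-- Gödel's β function

∣-! : ∀ {d l} → 0 < d → d ≤ l → d ∣ᴺ l !
∣-! {suc d} _ d≤l = ∣-trans (m∣m*n (d !)) (m≤n⇒m!∣n! d≤l)

coprime-* : ∀ {k m n} → Coprime k n → Coprime m n → Coprime (k * m) n
coprime-* {k} {m} {n} c c′ {d} (d∣km , d∣n) = c′ (coprime-divisor d⊥k d∣km , d∣n)
  where
  d⊥k : Coprime d k
  d⊥k (e∣d , e∣k) = c (e∣k , ∣-trans e∣d d∣n)

inverse : ∀ {P m} → 1 < m → Coprime P m → ∃ λ u → ∃ λ w → P * u ≡ 1 + w * m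
inverse {P} {m} 1<m c with coprime-Bézout c
... | Bézout.+- x y e = x , y , trans (ℕ.*-comm P x) (sym e)
... | Bézout.-+ x y e with x * P in xP
...   | zero  = Empty-elim (ℕ.<⇒≢ 1<m (sym (ℕ.m*n≡1⇒n≡1 y m (sym e))))
-- Here x P is congruent to -1 modulo `m`, so its square is congruent to 1 and x (x P) is an inverse
-- of `P`.
...   | suc z = x * (x * P) , z * y , (begin
  P * (x * (x * P))    ≡⟨ regroup P x ⟩
  (x * P) * (x * P)    ≡⟨ cong (λ t → t * t) xP ⟩
  suc z * suc z        ≡⟨ square z ⟩
  1 + z * (1 + suc z)  ≡⟨ cong (λ t → 1 + z * t) e ⟩
  1 + z * (y * m)      ≡⟨ cong (1 +_) (sym (ℕ.*-assoc z y m)) ⟩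
  1 + z * y * m        ∎)
  where
  open ≡-Reasoning
  regroup : ∀ P x → P * (x * (x * P)) ≡ (x * P) * (x * P)
  regroup = solve-∀
  square : ∀ z → suc z * suc z ≡ 1 + z * (1 + suc z)
  square = solve-∀

m≤[i+1]*m : ∀ i m → m ≤ (i + 1) * m
m≤[i+1]*m i m = subst (_≤ (i + 1) * m) (ℕ.*-identityˡ m) (ℕ.*-monoˡ-≤ m (ℕ.m≤n+m 1 i))

module Chinese (b l : ℕ) (1≤b : 1 ≤ b) (∣b : ∀ d → 0 < d → d ≤ l → d ∣ᴺ b) where

  -- A common divisor `d` is coprime to `b` and divides b (j - i), hence divides j - i. As j - i is
  -- at most `l`, it divides `b`, so `d` divides `b` as well and is 1.
  coprime-moduli : ∀ {i j} → i < j → j < l → Coprime (modulus b i) (modulus b j)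
  coprime-moduli {i} {j} i<j j<l {d} (d∣i , d∣j) = ∣1⇒≡1 (∣m+n∣m⇒∣n
    (subst (d ∣ᴺ_) (ℕ.+-comm 1 ((i + 1) * b)) d∣i) (∣n⇒∣m*n (i + 1) d∣b))
    where
    c = j ∸ i
    difference : modulus b i + b * c ≡ modulus b j
    difference = trans (distribute i c b) (cong (modulus b) (ℕ.m+[n∸m]≡n (ℕ.<⇒≤ i<j)))
      where
      distribute : ∀ i c b → 1 + (i + 1) * b + b * c ≡ 1 + (i + c + 1) * b
      distribute = solve-∀
    d⊥b : Coprime d b
    d⊥b {e} (e∣d , e∣b) = ∣1⇒≡1 (∣m+n∣m⇒∣n
      (subst (e ∣ᴺ_) (ℕ.+-comm 1 ((i + 1) * b)) (∣-trans e∣d d∣i)) (∣n⇒∣m*n (i + 1) e∣b))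
    d∣b : d ∣ᴺ b
    d∣b = ∣-trans (coprime-divisor d⊥b (∣m+n∣m⇒∣n (subst (d ∣ᴺ_) (sym difference) d∣j) d∣i))
                  (∣b c (ℕ.m<n⇒0<n∸m i<j) (ℕ.≤-trans (ℕ.m∸n≤m j i) (ℕ.<⇒≤ j<l)))

  -- Induction on `j`, with `P` the product of the moduli treated so far: adding a multiple of `P`
  -- to `a` keeps the earlier congruences.
  solution : (f : ℕ → ℕ) → ∀ j → j ≤ l → ∃ λ a → ∃ λ P →
    (∀ i → i < j → ∃ λ q → a ≡ q * modulus b i + f i) ×
    (∀ i → i < j → modulus b i ∣ᴺ P) ×
    (∀ i → j ≤ i → i < l → Coprime P (modulus b i))
  solution f zero    _   = 0 , 1 , (λ _ ()) , (λ _ ()) , λ i _ _ → Coprimality.1-coprimeTo _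
  solution f (suc j) j<l with solution f j (ℕ.<⇒≤ j<l)
  ... | a , P , eqs , divs , cops
    with inverse (s≤s (ℕ.≤-trans 1≤b (m≤[i+1]*m j b))) (cops j ℕ.≤-refl j<l)
  ...   | u , w , Pu = a + P * t , P * modulus b j , eqs′ , divs′ , cops′
    where
    open ≡-Reasoning
    m′ = (j + 1) * b
    -- `u` inverts `P` and `m′` is congruent to -1 modulo `modulus b j`, so `P * t` is congruent to
    -- f j - a, with no subtraction.
    t = u * (f j + m′ * a)
    new : a + P * t ≡ (a + w * (f j + m′ * a)) * modulus b j + f j
    new = begin
      a + P * (u * (f j + m′ * a))                        ≡⟨ cong (a +_) (sym (ℕ.*-assoc P u _)) ⟩
      a + P * u * (f j + m′ * a)                          ≡⟨ cong (λ x → a + x * (f j + m′ * a)) Pu ⟩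
      a + (1 + w * suc m′) * (f j + m′ * a)               ≡⟨ rearrange a w m′ (f j) ⟩
      (a + w * (f j + m′ * a)) * suc m′ + f j             ∎
      where
      rearrange : ∀ a w m f → a + (1 + w * suc m) * (f + m * a) ≡ (a + w * (f + m * a)) * suc m + f
      rearrange = solve-∀
    eqs′ : ∀ i → i < suc j → ∃ λ q → a + P * t ≡ q * modulus b i + f i
    eqs′ i i<1+j with ℕ.m≤n⇒m<n∨m≡n (ℕ.≤-pred i<1+j)
    ... | inj₂ refl = a + w * (f j + m′ * a) , new
    ... | inj₁ i<j with eqs i i<j | divs i i<j
    ...   | q , e | divides r e′ = q + r * t , (begin
      a + P * t                                     ≡⟨ cong₂ (λ x y → x + y * t) e e′ ⟩
      q * modulus b i + f i + r * modulus b i * t   ≡⟨ collect q (modulus b i) (f i) r t ⟩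
      (q + r * t) * modulus b i + f i               ∎)
      where
      collect : ∀ q m f r t → q * m + f + r * m * t ≡ (q + r * t) * m + f
      collect = solve-∀
    divs′ : ∀ i → i < suc j → modulus b i ∣ᴺ P * modulus b j
    divs′ i i<1+j with ℕ.m≤n⇒m<n∨m≡n (ℕ.≤-pred i<1+j)
    ... | inj₂ refl = n∣m*n P
    ... | inj₁ i<j  = ∣m⇒∣m*n (modulus b j) (divs i i<j)
    cops′ : ∀ i → suc j ≤ i → i < l → Coprime (P * modulus b j) (modulus b i)
    cops′ i j<i i<l = coprime-* (cops i (ℕ.<⇒≤ j<i) i<l) (coprime-moduli j<i i<l)

bound : (f : ℕ → ℕ) → ∀ l → ∃ λ M → ∀ i → i < l → f i ≤ M
bound f zero    = 0 , λ _ ()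
bound f (suc l) with bound f l
... | M , h = M ⊔ f l , go
  where
  go : ∀ i → i < suc l → f i ≤ M ⊔ f l
  go i i<1+l with ℕ.m≤n⇒m<n∨m≡n (ℕ.≤-pred i<1+l)
  ... | inj₁ i<l  = ℕ.≤-trans (h i i<l) (ℕ.m≤m⊔n M (f l))
  ... | inj₂ refl = ℕ.m≤n⊔m M (f l)

β : (f : ℕ → ℕ) → ∀ l → ∃ λ a → ∃ λ b → ∀ i → i < l → Bet a b i (f i)
β f l with bound f l
... | M , f≤M with Chinese.solution b l 1≤b ∣b f l ℕ.≤-refl
  where
  -- The factorial makes the moduli pairwise coprime; the factor `suc M` makes them exceed all
  -- values of `f`.
  b = l ! * suc M
  1≤b : 1 ≤ b
  1≤b = ℕ.*-mono-≤ (ℕ.1≤n! l) (s≤s (z≤n {M}))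
  ∣b : ∀ d → 0 < d → d ≤ l → d ∣ᴺ b
  ∣b d 0<d d≤l = ∣m⇒∣m*n (suc M) (∣-! 0<d d≤l)
... | a , _ , eqs , _ = a , l ! * suc M , λ i i<l →
  s≤s (ℕ.≤-trans (f≤M i i<l) (ℕ.≤-trans (ℕ.n≤1+n M) (ℕ.≤-trans
    (ℕ.m≤n*m (suc M) (l !) ⦃ l ℕ.!≢0 ⦄) (m≤[i+1]*m i (l ! * suc M))))) ,
  λ c → c (proj₁ (eqs i i<l)) (proj₂ (eqs i i<l))

-- Double negation commutes with finite conjunctions. This collects entries that exist only
-- classically into one function, as `β` requires.
choice : ∀ l {Q : ℕ → ℕ → Set} → (∀ i → i < l → ¬ ¬ ∃ (Q i)) →
         ¬ ¬ (∃ λ f → ∀ i → i < l → Q i (f i))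
choice zero    h k = k (id , λ _ ())
choice (suc l) {Q} h k =
  choice l {Q} (λ i i<l → h i (ℕ.m<n⇒m<1+n i<l)) λ (f , f-ok) →
  h l ℕ.≤-refl λ (v , v-ok) → k (update f v , update-ok f v f-ok v-ok)
  where
  update : (ℕ → ℕ) → ℕ → ℕ → ℕ
  update f v i with i ℕ.≟ l
  ... | yes _ = v
  ... | no  _ = f i
  update-ok : ∀ f v → (∀ i → i < l → Q i (f i)) → Q l v → ∀ i → i < suc l → Q i (update f v i)
  update-ok f v f-ok v-ok i i<1+l with i ℕ.≟ l
  ... | yes refl = v-ok
  ... | no  i≢l  = f-ok i (ℕ.≤∧≢⇒< (ℕ.≤-pred i<1+l) i≢l)

code-string : ∀ l {Q : ℕ → ℕ → Set} → (∀ i → i < l → ¬ ¬ ∃ (Q i)) →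
              ¬ ¬ (∃ λ s → Str s × (∀ i v → Ent s i v → i < l) ×
                           (∀ i → i < l → ∃ λ v → Q i v × Ent s i v))
code-string l {Q} h k = choice l {Q} h λ (f , f-ok) →
  let a , b , bet = β f l in
  k ( pr l (pr a b)
    , ex l (ex a (ex b refl))
    , (λ i v ent → proj₁ (Ent-elim l a b ent))
    , λ i i<l → f i , f-ok i i<l , Ent-intro l a b i<l (bet i i<l))

-- Oracle machines

-- Four registers are what the program `queryRoot` works with.
Regs : Set
Regs = Vec ℕ 4

State : Set
State = ℕ × Regs

data Instr : Set where
  Z S O : Fin 4 → Instr
  T     : Fin 4 → Fin 4 → Instr
  J     : Fin 4 → Fin 4 → ℕ → Instr

-- Values of `instr`, with 0 for missing operands.
codeI : Instr → ℕ
codeI (Z p)     = pr 0 (pr (toℕ p) (pr 0 0))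
codeI (S p)     = pr 1 (pr (toℕ p) (pr 0 0))
codeI (T p q)   = pr 2 (pr (toℕ p) (pr (toℕ q) 0))
codeI (O p)     = pr 3 (pr (toℕ p) (pr 0 0))
codeI (J p q l) = pr 4 (pr (toℕ p) (pr (toℕ q) l))

fetch : List Instr → ℕ → Maybe Instr
fetch []       _       = nothing
fetch (I ∷ Is) zero    = just I
fetch (I ∷ Is) (suc i) = fetch Is i

fetch-< : ∀ Is {i} → i < length Is → ∃ λ I → fetch Is i ≡ just I
fetch-< (I ∷ Is) {zero}  _         = I , refl
fetch-< (I ∷ Is) {suc i} (s≤s i<l) = fetch-< Is i<l

fetch-just : ∀ Is {i I} → fetch Is i ≡ just I → i < length Is
fetch-just (_ ∷ Is) {zero}  _ = s≤s z≤n
fetch-just (_ ∷ Is) {suc i} e = s≤s (fetch-just Is e)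

-- What the formula `Char` unfolds to.
CharOf : D → ℕ → ℕ → Set
CharOf X u w = ¬ (¬ (X ∋ u × w ≡ 1) × ¬ (¬ (X ∋ u) × w ≡ 0))

CharOf-total : ∀ X u → ¬ ¬ ∃ (CharOf X u)
CharOf-total X u k = ¬¬-excluded-middle λ
  { (yes u∈X) → k (1 , λ h → proj₁ h (u∈X , refl))
  ; (no  u∉X) → k (0 , λ h → proj₂ h (u∉X , refl)) }

module Machine (F : D) (Is : List Instr) where

  data Effect : Instr → State → State → Set where
    zeroed   : ∀ p {i R} → Effect (Z p) (i , R) (i + 1 , R [ p ]≔ 0)
    succ     : ∀ p {i R} → Effect (S p) (i , R) (i + 1 , R [ p ]≔ (lookup R p + 1))
    copied   : ∀ p q {i R} → Effect (T p q) (i , R) (i + 1 , R [ p ]≔ lookup R q)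
    asked    : ∀ p {i R w} → CharOf F (lookup R p) w → Effect (O p) (i , R) (i + 1 , R [ p ]≔ w)
    jumped   : ∀ p q l {i R} → lookup R p ≡ lookup R q → Effect (J p q l) (i , R) (l , R)
    unjumped : ∀ p q l {i R} → lookup R p ≢ lookup R q → Effect (J p q l) (i , R) (i + 1 , R)

  infix 4 _↦_
  _↦_ : State → State → Set
  s ↦ s′ = ∃ λ I → fetch Is (proj₁ s) ≡ just I × Effect I s s′

  data Run : ℕ → State → State → Set where
    done : ∀ {s} → Run 0 s s
    _◅_  : ∀ {d s s′ s″} → s ↦ s′ → Run d s′ s″ → Run (suc d) s s″

  infixr 5 _◅_

  trace : ∀ {d s s′} → Run d s s′ → ℕ → State
  trace {s = s} _        zero    = s
  -- Past the end of the run the last state is repeated.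
  trace {s = s} done     (suc t) = s
  trace         (_ ◅ r)  (suc t) = trace r t

  trace-end : ∀ {d s s′} (r : Run d s s′) → trace r d ≡ s′
  trace-end done    = refl
  trace-end (_ ◅ r) = trace-end r

  trace-step : ∀ {d s s′} (r : Run d s s′) t → t < d → trace r t ↦ trace r (t + 1)
  trace-step (e ◅ done)    zero    _         = e
  trace-step (e ◅ (_ ◅ _)) zero    _         = e
  trace-step (_ ◅ r)       (suc t) (s≤s t<d) = trace-step r t t<d

  Reach : State → State → Set
  Reach s s′ = ∃ λ d → Run d s s′

  _⊙_ : ∀ {s s′ s″} → Reach s s′ → Reach s′ s″ → Reach s s″
  (_ , done)    ⊙ r′ = r′
  (_ , (e ◅ r)) ⊙ r′ = let d , r″ = (_ , r) ⊙ r′ in suc d , e ◅ r″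

  step : ∀ {s s′ s″} → s ↦ s′ → Reach s′ s″ → Reach s s″
  step e (d , r) = suc d , e ◅ r

  -- The formula Step with F as oracle and four registers.
  StepAt : (e c h t : ℕ) → Set
  StepAt e c h t = Sat {1} {5} (Step zero v₄ v₃ v₂ v₁ v₀) (inst F λ ())
    (inst t (inst h (inst c (inst 4 (inst e λ ())))))

  Recorded : (c h t : ℕ) → State → Set
  Recorded c h t (i , R) = Ent c t i × (∀ r → Ent h (pr t (toℕ r)) (lookup R r))

  module _ {e c h t : ℕ} where

    others : ∀ (R R′ : Regs) p → (∀ r → Ent h (pr t (toℕ r)) (lookup R r)) →
             (∀ r → Ent h (pr (t + 1) (toℕ r)) (lookup R′ r)) →
             (∀ r → r ≢ p → lookup R′ r ≡ lookup R r) →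
             ∀ r → r < 4 × r ≢ toℕ p → ¬ (∀ z → ¬ (Ent h (pr t r) z × Ent h (pr (t + 1) r) z))
    others R R′ p old new same r (r<4 , r≢p) =
      let r′ = fromℕ< r<4 in
      subst (λ r → ¬ (∀ z → ¬ (Ent h (pr t r) z × Ent h (pr (t + 1) r) z))) (toℕ-fromℕ< r<4)
        (ex (lookup R r′)
          (old r′ , subst (Ent h _) (same r′ λ r′≡p → r≢p (trans (sym (toℕ-fromℕ< r<4)) (cong toℕ r′≡p)))
                      (new r′)))

    written : ∀ (R : Regs) p v → (∀ r → Ent h (pr t (toℕ r)) (lookup R r)) →
              (∀ r → Ent h (pr (t + 1) (toℕ r)) (lookup (R [ p ]≔ v) r)) →
              Ent h (pr (t + 1) (toℕ p)) v ×
              (∀ r → r < 4 × r ≢ toℕ p → ¬ (∀ z → ¬ (Ent h (pr t r) z × Ent h (pr (t + 1) r) z)))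
    written R p v old new =
      subst (Ent h _) (lookup∘updateAt p R) (new p) ,
      others R (R [ p ]≔ v) p old new (λ r r≢p → lookup∘updateAt′ r p r≢p R)

    stepAt : ∀ {I s s′} → Ent e (proj₁ s) (codeI I) → Effect I s s′ →
             Recorded c h t s → Recorded c h (t + 1) s′ → StepAt e c h t
    stepAt ent (zeroed p {i} {R}) (pc , old) (pc′ , new) =
      ex i (ex (i + 1) (ex (toℕ p) (ex 0 (ex 0 (ex 0
        ( pc , pc′ , toℕ<n p , s≤s z≤n
        , (λ u → proj₁ u (ent , refl , refl))
        , written R p 0 old new))))))
    stepAt ent (succ p {i} {R}) (pc , old) (pc′ , new) =
      ex i (ex (i + 1) (ex (toℕ p) (ex 0 (ex 0 (ex (lookup R p + 1)
        ( pc , pc′ , toℕ<n p , s≤s z≤n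
        -- `u` refutes the nested disjunction `Executes`; each `proj₂` passes one disjunct, and what
        -- follows proves the selected one.
        , (λ u → proj₂ u λ u → proj₁ u (ent , refl , ex (lookup R p) (old p , refl)))
        , written R p (lookup R p + 1) old new))))))
    stepAt ent (copied p q {i} {R}) (pc , old) (pc′ , new) =
      ex i (ex (i + 1) (ex (toℕ p) (ex (toℕ q) (ex 0 (ex (lookup R q)
        ( pc , pc′ , toℕ<n p , toℕ<n q
        , (λ u → proj₂ u λ u → proj₂ u λ u → proj₁ u (ent , refl , old q))
        , written R p (lookup R q) old new))))))
    stepAt ent (asked p {i} {R} {w} char) (pc , old) (pc′ , new) =
      ex i (ex (i + 1) (ex (toℕ p) (ex 0 (ex 0 (ex w
        ( pc , pc′ , toℕ<n p , s≤s z≤n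
        , (λ u → proj₂ u λ u → proj₂ u λ u → proj₂ u λ u →
            proj₁ u (ent , refl , ex (lookup R p) (old p , char)))
        , written R p w old new))))))
    stepAt ent (jumped p q l {i} {R} eq) (pc , old) (pc′ , new) =
      ex i (ex l (ex (toℕ p) (ex (toℕ q) (ex l (ex (lookup R p)
        ( pc , pc′ , toℕ<n p , toℕ<n q
        , (λ u → proj₂ u λ u → proj₂ u λ u → proj₂ u λ u → proj₂ u
            (ent , old p , ex (lookup R q) (old q , λ u → proj₁ u (eq , refl))))
        , new p
        , others R R p old new (λ r r≢p → refl)))))))
    stepAt ent (unjumped p q l {i} {R} neq) (pc , old) (pc′ , new) =
      ex i (ex (i + 1) (ex (toℕ p) (ex (toℕ q) (ex l (ex (lookup R p)
        ( pc , pc′ , toℕ<n p , toℕ<n q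
        , (λ u → proj₂ u λ u → proj₂ u λ u → proj₂ u λ u → proj₂ u
            (ent , old p , ex (lookup R q) (old q , λ u → proj₂ u (neq , refl))))
        , new p
        , others R R p old new (λ r r≢p → refl)))))))

-- The bound on the indices makes leaving the list a halt in the sense of `Computes`.
Codes : ℕ → List Instr → Set
Codes e Is = Str e × (∀ i v → Ent e i v → i < length Is) ×
             (∀ i I → fetch Is i ≡ just I → Ent e i (codeI I))

program-code : ∀ Is → ¬ ¬ ∃ λ e → Codes e Is
program-code Is k =
  code-string (length Is) {λ i v → ∀ I → fetch Is i ≡ just I → v ≡ codeI I}
    (λ i i<l k → let I , eq = fetch-< Is i<l in
       k (codeI I , λ I′ eq′ → cong codeI (just-injective (trans (sym eq) eq′))))
    λ (e , str , bounded , entries) → k (e , str , bounded , λ i I eq →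
      let v , v≡ , ent = entries i (fetch-just Is eq) in subst (Ent e i) (v≡ I eq) ent)

module Record (F : D) (Is : List Instr) where

  open Machine F Is

  module _ {d x i y R e} (run : Run d (0 , x ∷ 0 ∷ 0 ∷ 0 ∷ []) (i , y ∷ R))
           (halted : fetch Is i ≡ nothing) (codes : Codes e Is) where

    pcAt : ℕ → ℕ
    pcAt t = proj₁ (trace run t)

    regsAt : ℕ → Regs
    regsAt t = proj₂ (trace run t)

    HistoryEntry : ℕ → ℕ → Set
    HistoryEntry m v = ∀ t r → m ≡ pr t (toℕ r) → v ≡ lookup (regsAt t) r

    historyEntry : ∀ m → ¬ ¬ ∃ (HistoryEntry m)
    historyEntry m k = ¬¬-excluded-middle {A = Σ (ℕ × Fin 4) λ (t , r) → m ≡ pr t (toℕ r)} λ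
      { (yes ((t , r) , eq)) → k (lookup (regsAt t) r , λ t′ r′ eq′ → same t r t′ r′ (trans (sym eq) eq′))
      -- Default entry at positions that code no time and register.
      ; (no ¬pair) → k (0 , λ t r eq → Empty-elim (¬pair ((t , r) , eq))) }
      where
      same : ∀ t r t′ r′ → pr t (toℕ r) ≡ pr t′ (toℕ r′) → lookup (regsAt t) r ≡ lookup (regsAt t′) r′
      same t r t′ r′ eq with pr-injective {t} {toℕ r} {t′} {toℕ r′} eq
      ... | refl , eq′ = cong (lookup (regsAt t)) (toℕ-injective eq′)

    computes : ∀ {m n} {μ : Fin m → D} {ν : Fin n → ℕ} →
               Sat (Computes zero v₂ v₁ v₀) (inst F μ) (inst y (inst x (inst e ν)))
    computes refute =
      code-string (suc d) {λ t v → v ≡ pcAt t} (λ t _ k → k (pcAt t , refl))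
        λ (c , _ , _ , c-entries) →
      -- For t ≤ d and r < 4 the sum t + r is below `suc d + 4`, so by `square-gap` this length
      -- covers all positions `pr t r`.
      code-string (pr (suc d) 4) {HistoryEntry} (λ m _ → historyEntry m)
        λ (h , _ , _ , h-entries) →
      let
        recorded : ∀ t → t ≤ d → Recorded c h t (trace run t)
        recorded t t≤d =
          (let v , v≡ , ent = c-entries t (s≤s t≤d) in subst (Ent c t) v≡ ent) ,
          λ r → let v , v≡ , ent = h-entries (pr t (toℕ r))
                                     (square-gap {t} {toℕ r} {suc d} {4}
                                       (ℕ.+-mono-≤-< (ℕ.m≤n⇒m≤1+n t≤d) (toℕ<n r)))
                in subst (Ent h _) (v≡ t r refl) ent
        final : Recorded c h d (i , y ∷ R)
        final = subst (Recorded c h d) (trace-end run) (recorded d ℕ.≤-refl)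
        initial = recorded 0 z≤n
        entries = proj₂ (proj₂ codes)
      in
      refute 4 (ex c (ex h (ex d
        ( s≤s z≤n
        , proj₁ initial
        , proj₂ initial zero
        , (λ r (r<4 , r≢0) → initial-zero h (proj₂ initial) r r<4 r≢0)
        , (λ t t<d → let I , eq , effect = trace-step run t t<d in
             stepAt {e} {c} {h} {t} (entries _ I eq) effect (recorded t (ℕ.<⇒≤ t<d))
               (recorded (t + 1) (subst (_≤ d) (ℕ.+-comm 1 t) t<d)))
        , ex i (proj₁ final , λ has-entry → has-entry λ v ent →
             no-instruction (proj₁ (proj₂ codes) i v ent))
        , proj₂ final zero ))))
      where
      initial-zero : ∀ h → (∀ r → Ent h (pr 0 (toℕ r)) (lookup (regsAt 0) r)) →
                     ∀ r → r < 4 → r ≢ 0 → Ent h (pr 0 r) 0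
      initial-zero h old 0 _ r≢0 = Empty-elim (r≢0 refl)
      initial-zero h old 1 _ _   = old (suc zero)
      initial-zero h old 2 _ _   = old (suc (suc zero))
      initial-zero h old 3 _ _   = old (suc (suc (suc zero)))
      initial-zero h old (suc (suc (suc (suc r)))) (s≤s (s≤s (s≤s (s≤s ())))) _
      no-instruction : ¬ (i < length Is)
      no-instruction i<l with fetch-< Is i<l
      ... | I , eq with () ← trans (sym halted) eq

-- A program that reads a set off a path.

r₀ r₁ r₂ r₃ : Fin 4
r₀ = zero
r₁ = suc zero
r₂ = suc (suc zero)
r₃ = suc (suc (suc zero))

-- On input x, accumulates 2 + Σ_{1≤i≤x} (2 + 8 i) = pr (1 + 2 x) 0 in r₂ and asks
-- the oracle about it.
queryRoot : List Instr
queryRoot =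
  S r₂ ∷ S r₂ ∷
  J r₁ r₀ 18 ∷ S r₁ ∷ S r₂ ∷ S r₂ ∷ Z r₃ ∷
  J r₃ r₁ 2 ∷ S r₂ ∷ S r₂ ∷ S r₂ ∷ S r₂ ∷ S r₂ ∷ S r₂ ∷ S r₂ ∷ S r₂ ∷ S r₃ ∷ J r₀ r₀ 7 ∷
  T r₀ r₂ ∷ O r₀ ∷ []

-- The code `x + x` of `root x`, shifted by one for the first entry, paired with the value 0: the
-- graph of a path contains this number if and only if `root x` is in the kernel.
query : ℕ → ℕ
query x = pr (suc (x + x)) 0

module _ (F : D) where

  open Machine F queryRoot

  inc² inc⁸ : ℕ → ℕ
  inc² a = a + 1 + 1
  inc⁸ a = a + 1 + 1 + 1 + 1 + 1 + 1 + 1 + 1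

  -- `m` counts the remaining rounds of the loop at instruction 7, each of which adds 8 to register
  -- 2.
  inner : ∀ m {x i a k} → k + m ≡ i → ∃ λ a′ → a′ ≡ a + 8 * m ×
          Reach (7 , x ∷ i ∷ a ∷ k ∷ []) (2 , x ∷ i ∷ a′ ∷ i ∷ [])
  inner zero {x} {i} {a} {k} e with refl ← trans (sym (ℕ.+-identityʳ k)) e =
    a , sym (ℕ.+-identityʳ a) ,
    step (_ , refl , jumped r₃ r₁ 2 refl) (0 , done)
  inner (suc m) {x} {i} {a} {k} e =
    let a′ , a′≡ , r = inner m {x} {i} {inc⁸ a} {k + 1} (trans (ℕ.+-assoc k 1 m) e) in
    a′ , trans a′≡ (shift a m) ,
    step (_ , refl , unjumped r₃ r₁ 2 k≢i)
    (step (_ , refl , succ r₂) (step (_ , refl , succ r₂) (step (_ , refl , succ r₂)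
    (step (_ , refl , succ r₂) (step (_ , refl , succ r₂) (step (_ , refl , succ r₂)
    (step (_ , refl , succ r₂) (step (_ , refl , succ r₂)
    (step (_ , refl , succ r₃) (step (_ , refl , jumped r₀ r₀ 7 refl) r))))))))))
    where
    k≢i : k ≢ i
    k≢i refl = ℕ.m+1+n≢m k e
    shift : ∀ a m → a + 1 + 1 + 1 + 1 + 1 + 1 + 1 + 1 + 8 * m ≡ a + 8 * suc m
    shift = solve-∀

  -- Invariant of the loop at instruction 2, with `m` rounds remaining: register 2 holds `query i`.
  -- Passing from i to i + 1 adds 2 + 8 (i + 1).
  outer : ∀ m {x i k} → i + m ≡ x → ∃ λ k′ →
          Reach (2 , x ∷ i ∷ query i ∷ k ∷ []) (18 , x ∷ x ∷ query x ∷ k′ ∷ [])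
  outer zero {x} {i} {k} e with refl ← trans (sym (ℕ.+-identityʳ i)) e =
    k , step (_ , refl , jumped r₁ r₀ 18 refl) (0 , done)
  outer (suc m) {x} {i} {k} e =
    let a , a≡ , r = inner (i + 1) {x} {i + 1} {inc² (query i)} {0} refl
        k′ , r′ = outer m {x} {i + 1} {i + 1} (trans (ℕ.+-assoc i 1 m) e) in
    k′ ,
    step (_ , refl , unjumped r₁ r₀ 18 i≢x)
    (step (_ , refl , succ r₁) (step (_ , refl , succ r₂) (step (_ , refl , succ r₂)
    (step (_ , refl , zeroed r₃)
    (r ⊙ subst (λ a → Reach (2 , x ∷ i + 1 ∷ a ∷ i + 1 ∷ []) (18 , x ∷ x ∷ query x ∷ k′ ∷ []))
           (sym (trans a≡ (next i))) r′)))))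
    where
    i≢x : i ≢ x
    i≢x refl = ℕ.m+1+n≢m i e
    next : ∀ i → (suc (i + i) + 0) * (suc (i + i) + 0) + suc (i + i) + 1 + 1 + 8 * (i + 1) ≡
                 (suc (i + 1 + (i + 1)) + 0) * (suc (i + 1 + (i + 1)) + 0) + suc (i + 1 + (i + 1))
    next = solve-∀

  run : ∀ x {w} → CharOf F (query x) w → ∃ λ R →
        Reach (0 , x ∷ 0 ∷ 0 ∷ 0 ∷ []) (20 , w ∷ R)
  run x c =
    let k′ , r = outer x {x} {0} {0} refl in
    x ∷ query x ∷ k′ ∷ [] ,
    -- The two increments produce `query 0`, which is 2.
    step (_ , refl , succ r₂) (step (_ , refl , succ r₂)
      (r ⊙ step (_ , refl , copied r₀ r₂) (step (_ , refl , asked r₀ c) (0 , done))))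

CharOf-cong : ∀ {X Y u v w} → (X ∋ u) ⟺ (Y ∋ v) → CharOf X u w → CharOf Y v w
CharOf-cong (f , g) h (a , b) = h ((λ (c , e) → a (f c , e)) , (λ (c , e) → b (c ∘ g , e)))

-- One program serves all sets `X`, with a single oracle question for each input.
reducible : ∀ X F → (∀ x → (F ∋ query x) ⟺ (X ∋ x)) → ∀ {m n} {μ : Fin m → D} {ν : Fin n → ℕ} →
            Sat (suc zero ≤ᵀ zero) (inst F (inst X μ)) ν
reducible X F same {μ = μ} {ν} refute =
  program-code queryRoot λ (e , codes) → refute e (proj₁ codes , λ x refute →
    CharOf-total F (query x) λ (w , c) →
    let R , d , r = run F x c in
    refute w (CharOf-cong {F} {X} (same x) c ,
              Record.computes F queryRoot r refl codes {μ = inst X μ} {ν}))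

-- Cofinality and the conclusion.

treeSet-cofinal : ∀ {μ : Fin 0 → D} {ν : Fin 0 → ℕ} → Sat (CofinalPaths zero) (inst treeSet μ) ν
treeSet-cofinal {μ} {ν} X refute =
  refute F (graphSet-isPath n X {μ} {ν} , reducible X F same {μ = inst treeSet μ} {ν})
  where
  -- The first component makes `n` at least the height of `neg X`, the second makes `neg X` the
  -- formula below each root. The negation is cancelled by the one in `W-root`.
  n = pr (height (neg X)) (encD (neg X))
  F = proj₁ (graphSet n)
  h = height (neg X)
  same : ∀ x → (F ∋ query x) ⟺ (X ∋ x)
  same x = ⟺-trans (proj₂ (graphSet n) (query x)) (⟺-trans (GraphCode-pr n (suc (x + x)) 0)
    (⟺-trans (subst (λ p → W n (x + x) ⟺ W n p) (sym (code-root x)) (id , id))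
    (⟺-trans (W-root h (neg X) x)
    (⟺-trans (¬-cong (W-⟦⟧ h (neg X) (neg X) (x ∷ []) (x≤pr h (encD (neg X)))))
      ((λ k → ⟦⟧-stable X (x ∷ []) λ ¬a → k (¬a , ¬a)) , λ a (¬a , _) → ¬a a)))))

proposition3p4 : ¬ (ACA₀ ⊢ wMPT)
proposition3p4 proof =
  soundness (ACA₀-sound comprehension-holds) proof {noSets} {noNumbers} [] treeSet
    (treeSet-isTree {noSets} {noNumbers} , treeSet-cofinal {noSets} {noNumbers})
    (treeSet-noPerfect {noSets} {noNumbers})
  where
  noSets : Fin 0 → D
  noSets ()
  noNumbers : Fin 0 → ℕ
  noNumbers ()
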